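{- Let $\lambda$ be a Dyck path of order $n$ and $\sigma\in\mathscr{L}(P_\lambda)$; let $L$ be the natural labeling with $L_0\circ L^{ -1}=\sigma$, and for $i\in[n]$ let $\ell_i$ and $r_i$ be the positions (in $\{1,\dots,2n\}$) of the up step and down step of the chord with $L$-label $i$. Let $T=\operatorname{DTR}(\lambda,\sigma)$ and $\ell=\ell_1\cdots\ell_n$. Then $$\operatorname{area}(T)=\sum_{i\in\operatorname{DES}(\ell)}(\ell_i-r_{i+1}),\qquad \operatorname{tiles}(T)=\sum_{i\in\operatorname{DES}(\ell)}\Big(\ell_i-r_{i+1}-2\,\#\{j>i+1: r_{i+1}<\ell_j<\ell_i\}\Big).$$
   Context: For a word $w=w_1\cdots w_n$, $\operatorname{DES}(w)=\{i<n:w_i>w_{i+1}\}$. Dyck paths. A Dyck path of order $n$ is a lattice path from $(-n,0)$ to $(n,0)$ with steps $(+1,+1)$ (U) and $(+1,-1)$ (D) never going below the $x$-axis; $\rho(x)$ is its height at $x$; steps are numbered $1,\dots,2n$ left to right. Column $s$ is the line $x=s$. Each up step is matched with a down step as in balanced parentheses; such a pair is a chord. Chord poset $P_\lambda$: $c<c'$ iff both steps of $c'$ lie strictly between those of $c$. A natural labeling is a bijection $L:P_\lambda\to[n]$ with $L(c)<L(c')$ whenever $c<c'$; $L_0$ numbers chords by the left-to-right order of their up steps; $\mathscr{L}(P_\lambda)=\{L_0\circ L^{ -1}:L\text{ natural}\}$. Growth sequences. A growth sequence of length $n$ is $(p_1,\dots,p_n)$ with $0\le p_i\le 2(i-1)$;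 it determines $(\lambda,L)$ by starting with the empty word and, for $i=1,\dots,n$, inserting UD immediately after the first $p_i$ letters and labeling the new chord $i$. This is a bijection onto pairs ($\lambda$, natural labeling); $p(\lambda,\sigma)$ is the sequence giving $(\lambda,L)$ with $L_0\circ L^{ -1}=\sigma$. Dyck tilings. A box is a square with vertices $(x,y),(x+1,y+1),(x,y+2),(x-1,y+1)$ (lower corner $(x,y)$, column $x$). For Dyck paths $\lambda,\mu$ of order $n$ with $\mu$ weakly above $\lambda$, a Dyck tiling of $\lambda/\mu$ is a partition of the boxes between them into Dyck tiles: nonempty sets of boxes, one in each of a set of consecutive columns, whose lower corners read left to right form a lattice path with steps $(+1,\pm1)$ with first and last points of equal height and none lower. $\operatorname{area}(T)$ is the number of boxes and $\operatorname{tiles}(T)$ the number of tiles. Spread. The spread at column $s$ of a path $\rho$ is $\{(x-1,y):(x,y)\in\rho,x\le s\}\cup\{(x,y+1):(x,y)\in\rho,x=s\}\cup\{(x+1,y):(x,y)\in\rho,x\ge s\}$; spreading a tiling spreads lower path, upper path and all tile lower-corner paths. For a tiling with upper path $\mu$, column $s$ is eligible if $\mu$ has an up step ending in column $s$ and the point of $\mu$ at column $s$ is not the top corner of a one-box tile; the special column is the rightmost eligible column. DTR. For $T$ of order $n$, $-n\le s\le n$, let $T''$ be the spread of $T$ at $s$, with upper path $\mu''$ and special column $Q$; $\mathrm{rgrow}(T,s)$ is $T''$ plus, if $Q>s$, the one-box tiles with lower corners $(c,\mu''(c))$ for $s<c<Q$. $\operatorname{DTR}()$ is the empty tiling of order $0$;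 $\operatorname{DTR}(p_1,\dots,p_n)=\mathrm{rgrow}(\operatorname{DTR}(p_1,\dots,p_{n-1}),p_n-(n-1))$; $\operatorname{DTR}(\lambda,\sigma)=\operatorname{DTR}(p(\lambda,\sigma))$. -}

module Defs where

open import Data.Nat as ℕ using (ℕ; zero; suc; _≤_; _<_; _*_)
open import Data.Integer as ℤ using (ℤ; +_; 0ℤ; 1ℤ)
open import Data.Fin using (Fin; toℕ; fromℕ<)
open import Data.List using (List; []; _∷_; _++_; take; drop; map; length; filter; concat; concatMap; upTo; foldr; last)
open import Data.Maybe using (Maybe; just; nothing)
open import Data.Product using (_×_; _,_; proj₁; proj₂)
open import Data.Unit using (⊤)
open import Data.Bool using (Bool; true; false; if_then_else_; _∧_; not)
open import Relation.Nullary using (¬_)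
open import Relation.Nullary.Decidable using (⌊_⌋; _×-dec_)
open import Relation.Binary.PropositionalEquality using (_≡_)

data Step : Set where
  U D : Step

-- 1-based lookup
at : {A : Set} → List A → ℕ → Maybe A
at [] _ = nothing
at (x ∷ xs) zero = nothing
at (x ∷ xs) (suc zero) = just x
at (x ∷ xs) (suc (suc k)) = at xs (suc k)

data Bal : ℕ → List Step → Set where
  bal-[] : Bal 0 []
  bal-U  : ∀ {h w} → Bal (suc h) w → Bal h (U ∷ w)
  bal-D  : ∀ {h w} → Bal h w → Bal (suc h) (D ∷ w)

IsDyck : ℕ → List Step → Set
IsDyck n w = (length w ≡ 2 * n) × Bal 0 w

-- matchFrom d pos w : scanning w (whose letters have positions pos+1, pos+2, ...)
-- with current depth d, position of the down step closing depth 0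
matchFrom : ℕ → ℕ → List Step → ℕ
matchFrom d pos [] = 0
matchFrom d pos (U ∷ w) = matchFrom (suc d) (suc pos) w
matchFrom zero pos (D ∷ w) = suc pos
matchFrom (suc d) pos (D ∷ w) = matchFrom d (suc pos) w

-- position of the down step matched with the up step at position a (1-based)
mate : List Step → ℕ → ℕ
mate w a = matchFrom 0 a (drop a w)

-- chords are identified by the position of their up step.
-- Chord b is above chord a in P_λ (a < b) iff both steps of b lie strictly
-- between those of a.
ChordLt : List Step → ℕ → ℕ → Set
ChordLt w a b = (a < b) × (mate w b < mate w a)

-- A natural labeling L, given through its inverse lab = L⁻¹ : labels → chords
-- (label i ∈ [n] is represented by the Fin n element with toℕ = i - 1).
record NaturalLabeling (n : ℕ) (w : List Step) (lab : Fin n → ℕ) : Set where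
  field
    isChord   : ∀ i → at w (lab i) ≡ just U
    injective : ∀ i j → lab i ≡ lab j → i ≡ j
    natural   : ∀ i j → ChordLt w (lab i) (lab j) → toℕ i ℕ.< toℕ j

-- validFrom k p : p = (p_{k+1}, p_{k+2}, ...) with p_i ≤ 2(i-1)
validFrom : ℕ → List ℕ → Set
validFrom k [] = ⊤
validFrom k (x ∷ xs) = (x ≤ 2 * k) × validFrom (suc k) xs

GrowthSeq : ℕ → List ℕ → Set
GrowthSeq n p = (length p ≡ n) × validFrom 0 p

-- labeled word: each step carries the label of its chord
insertUD : ℕ → ℕ → List (Step × ℕ) → List (Step × ℕ)
insertUD i q w = take q w ++ ((U , i) ∷ (D , i) ∷ drop q w)

genFrom : ℕ → List ℕ → List (Step × ℕ) → List (Step × ℕ)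
genFrom k [] w = w
genFrom k (x ∷ xs) w = genFrom (suc k) xs (insertUD (suc k) x w)

gen : List ℕ → List (Step × ℕ)
gen p = genFrom 0 p []

-- p generates (λ, L): i.e. p = p(λ, σ) with σ = L₀ ∘ L⁻¹
Generates : {n : ℕ} → List ℕ → List Step → (Fin n → ℕ) → Set
Generates p w lab =
  (map proj₁ (gen p) ≡ w) × (∀ i → at (gen p) (lab i) ≡ just (U , suc (toℕ i)))

Point : Set
Point = ℤ × ℕ

-- a tiling: lower path (list of its points, left to right) and list of tiles,
-- each tile given by the list of lower corners of its boxes (left to right).
record Tiling : Set where
  constructor tiling
  field
    lower : List Point
    tileList : List (List Point)
open Tiling public

area : Tiling → ℕ
area T = length (concat (tileList T))

tiles : Tiling → ℕ
tiles T = length (tileList T)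

spreadPt : ℤ → Point → List Point
spreadPt s (x , y) =
  if ⌊ x ℤ.<? s ⌋ then (x ℤ.- 1ℤ , y) ∷ []
  else if ⌊ x ℤ.≟ s ⌋ then (x ℤ.- 1ℤ , y) ∷ (x , suc y) ∷ (x ℤ.+ 1ℤ , y) ∷ []
  else (x ℤ.+ 1ℤ , y) ∷ []

spreadPath : ℤ → List Point → List Point
spreadPath s = concatMap (spreadPt s)

spread : ℤ → Tiling → Tiling
spread s T = tiling (spreadPath s (lower T)) (map (spreadPath s) (tileList T))

heightAt : List Point → ℤ → ℕ
heightAt [] c = 0
heightAt ((x , y) ∷ ps) c = if ⌊ x ℤ.≟ c ⌋ then y else heightAt ps c

boxesAt : Tiling → ℤ → ℕ
boxesAt T c = length (filter (λ q → proj₁ q ℤ.≟ c) (concat (tileList T)))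

-- the upper path: each box in column c raises the region by 2 there
upper : Tiling → ℤ → ℕ
upper T c = heightAt (lower T) c ℕ.+ 2 * boxesAt T c

columns : Tiling → List ℤ
columns T = map proj₁ (lower T)

isOneBoxAt : ℤ → ℕ → List Point → Bool
isOneBoxAt c y ((x , z) ∷ []) = ⌊ x ℤ.≟ c ⌋ ∧ ⌊ z ℕ.≟ y ⌋
isOneBoxAt c y _ = false

anyB : {A : Set} → (A → Bool) → List A → Bool
anyB f = foldr (λ a b → f a Data.Bool.∨ b) false

-- column c eligible: the upper path has an up step ending in column c and
-- (c, μ(c)) is not the top corner (c, y+2) of a one-box tile with lower corner (c, y)
eligible : Tiling → ℤ → Bool
eligible T c =
  ⌊ upper T c ℕ.≟ suc (upper T (c ℤ.- 1ℤ)) ⌋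
  ∧ not (anyB (λ t → anyB (λ y → isOneBoxAt c y t ∧ ⌊ y ℕ.+ 2 ℕ.≟ upper T c ⌋)
                         (map proj₂ t)) (tileList T))

special : Tiling → Maybe ℤ
special T = last (filter (λ c → Data.Bool.T? (eligible T c)) (Data.List.drop 1 (columns T)))

rgrow : Tiling → ℤ → Tiling
rgrow T s with spread s T
... | T'' with special T''
...   | nothing = T''
...   | just Q =
  if ⌊ s ℤ.<? Q ⌋
  then tiling (lower T'')
         (tileList T'' ++
           map (λ c → (c , upper T'' c) ∷ [])
             (filter (λ c → s ℤ.<? c ×-dec c ℤ.<? Q) (columns T'')))
  else T''

emptyTiling : Tiling
emptyTiling = tiling ((0ℤ , 0) ∷ []) []

DTRfrom : ℕ → List ℕ → Tiling → Tiling
DTRfrom k [] T = T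
DTRfrom k (x ∷ xs) T = DTRfrom (suc k) xs (rgrow T (+ x ℤ.- + k))

DTR : List ℕ → Tiling
DTR p = DTRfrom 0 p emptyTiling

-- extend a function on labels Fin n (label i ↔ toℕ = i-1) to 1-based ℕ indices
liftFin : {n : ℕ} → (Fin n → ℕ) → ℕ → ℕ
liftFin f zero = 0
liftFin {n} f (suc k) with k ℕ.<? n
... | Relation.Nullary.yes k<n = f (fromℕ< k<n)
... | Relation.Nullary.no _ = 0

sumℤ : List ℤ → ℤ
sumℤ = foldr ℤ._+_ 0ℤ

DES : ℕ → (ℕ → ℕ) → List ℕ
DES n ℓ = filter (λ i → ℓ (suc i) ℕ.<? ℓ i) (map suc (upTo (n ℕ.∸ 1)))

areaRHS : ℕ → (ℕ → ℕ) → (ℕ → ℕ) → ℤ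
areaRHS n ℓ r = sumℤ (map (λ i → + ℓ i ℤ.- + r (suc i)) (DES n ℓ))

crossCount : ℕ → (ℕ → ℕ) → (ℕ → ℕ) → ℕ → ℕ
crossCount n ℓ r i =
  length (filter (λ j → r (suc i) ℕ.<? ℓ j ×-dec ℓ j ℕ.<? ℓ i)
                 (map (λ k → k ℕ.+ (2 ℕ.+ i)) (upTo (n ℕ.∸ (suc i)))))

tilesRHS : ℕ → (ℕ → ℕ) → (ℕ → ℕ) → ℤ
tilesRHS n ℓ r =
  sumℤ (map (λ i → + ℓ i ℤ.- + r (suc i) ℤ.- + (2 * crossCount n ℓ r i)) (DES n ℓ))

-- Both sides are followed along the growth sequence.  After k steps the tiling lives on the
-- columns -k, …, k; shifting them to 0, …, 2k, a spread at q keeps the columns ≤ q, raises a new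
-- peak at q + 1 and moves everything right of q by 2.  Invariantly, the rightmost eligible column
-- is ℓ_k, the up step of the chord inserted last, so rgrow adds ℓ_k ∸ q one-box tiles, and column j
-- holds as many boxes as there are descents i with r_{i+1} ≤ j < ℓ_i.  On the word side, inserting
-- UD after q letters moves every position > q by 2: this adds to the area sum twice the number of
-- descents covering q (the boxes of column q, which the spread doubles) plus the new term ℓ_k ∸ q,
-- while an old term of the tiles sum is unchanged, because the new chord is one more crossing
-- exactly for the descents covering q.

module Submission where

open import Defs
open import Data.Bool using (Bool; true; false; if_then_else_; _∧_; _∨_; not; T?)
open import Data.Bool.Properties using (∨-identityʳ; ∨-zeroʳ; ∧-zeroʳ; ∧-identityʳ; ∨-assoc; not-¬; ∧-conicalˡ)
open import Data.Empty using (⊥-elim)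
open import Data.Fin using (Fin; toℕ; fromℕ<)
import Data.Fin.Properties as Finₚ
open import Data.Integer as ℤ using (ℤ; +_; 0ℤ; 1ℤ)
import Data.Integer.Properties as ℤₚ
open import Data.Integer.Tactic.RingSolver using (solve-∀)
import Data.Nat.Tactic.RingSolver as ℕ-Solver
open import Data.List using (List; []; _∷_; _++_; map; length; filter; concat; concatMap; take; drop; last; upTo; applyUpTo)
import Data.List.Properties as Listₚ
open import Data.List.Relation.Unary.All as All using (All; []; _∷_)
open import Data.List.Relation.Unary.Any using (Any; here; there)
open import Data.Maybe as Maybe using (Maybe; just; nothing)
open import Data.Nat as ℕ using (ℕ; zero; suc; _+_; _*_; _∸_; _≤_; _<_; pred; z≤n; s≤s; _⊔_)
import Data.Nat.Properties as ℕₚ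
open import Data.Product using (_×_; _,_; proj₁; proj₂; Σ-syntax)
open import Data.Sum using (_⊎_; inj₁; inj₂)
open import Function.Bundles using (_⇔_; mk⇔; module Equivalence)
open import Data.Product.Function.NonDependent.Propositional using (_×-⇔_)
import Data.List.Relation.Unary.All.Properties as Allₚ
open import Relation.Binary using (tri<; tri≈; tri>)
open import Relation.Binary.PropositionalEquality
open import Relation.Nullary using (Dec; yes; no; ¬_; does)
open import Relation.Nullary.Decidable using (⌊_⌋; _×-dec_; isYes≗does; dec-true; dec-false; does-⇔)

cong₃ : ∀ {A B C D : Set} (f : A → B → C → D) {a a′ b b′ c c′} →
        a ≡ a′ → b ≡ b′ → c ≡ c′ → f a b c ≡ f a′ b′ c′
cong₃ f refl refl refl = refl

isYes-true : ∀ {P : Set} (p : Dec P) → P → ⌊ p ⌋ ≡ true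
isYes-true p x = trans (isYes≗does p) (dec-true p x)

isYes-false : ∀ {P : Set} (p : Dec P) → ¬ P → ⌊ p ⌋ ≡ false
isYes-false p ¬x = trans (isYes≗does p) (dec-false p ¬x)

isYes-⇔ : ∀ {P Q : Set} → P ⇔ Q → (p : Dec P) (q : Dec Q) → ⌊ p ⌋ ≡ ⌊ q ⌋
isYes-⇔ P⇔Q p q = trans (isYes≗does p) (trans (does-⇔ P⇔Q p q) (sym (isYes≗does q)))

isYes-sound : ∀ {P : Set} (p : Dec P) → ⌊ p ⌋ ≡ true → P
isYes-sound (yes x) _ = x

does-sound : ∀ {P : Set} (p : Dec P) → does p ≡ true → P
does-sound (yes x) _ = x

≟-refl : ∀ a → ⌊ a ℕ.≟ a ⌋ ≡ true
≟-refl a = isYes-true (a ℕ.≟ a) refl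

≟-< : ∀ {a b} → a < b → ⌊ a ℕ.≟ b ⌋ ≡ false
≟-< {a} {b} a<b = isYes-false (a ℕ.≟ b) (ℕₚ.<⇒≢ a<b)

≟-> : ∀ {a b} → b < a → ⌊ a ℕ.≟ b ⌋ ≡ false
≟-> {a} {b} b<a = isYes-false (a ℕ.≟ b) (ℕₚ.>⇒≢ b<a)

≟-suc-suc : ∀ a b → ⌊ suc (suc a) ℕ.≟ suc (suc b) ⌋ ≡ ⌊ a ℕ.≟ b ⌋
≟-suc-suc a b = isYes-⇔ (mk⇔ (λ e → ℕₚ.suc-injective (ℕₚ.suc-injective e)) (cong (λ z → suc (suc z))))
  (suc (suc a) ℕ.≟ suc (suc b)) (a ℕ.≟ b)

anyB-map : ∀ {A B : Set} (f : B → Bool) (g : A → B) xs → anyB f (map g xs) ≡ anyB (λ x → f (g x)) xs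
anyB-map f g [] = refl
anyB-map f g (x ∷ xs) = cong (f (g x) ∨_) (anyB-map f g xs)

anyB-cong : ∀ {A : Set} {f g : A → Bool} → (∀ x → f x ≡ g x) → ∀ xs → anyB f xs ≡ anyB g xs
anyB-cong f≗g [] = refl
anyB-cong f≗g (x ∷ xs) = cong₂ _∨_ (f≗g x) (anyB-cong f≗g xs)

anyB-false : ∀ {A : Set} (xs : List A) → anyB (λ _ → false) xs ≡ false
anyB-false [] = refl
anyB-false (x ∷ xs) = anyB-false xs

anyB-++ : ∀ {A : Set} (f : A → Bool) xs ys → anyB f (xs ++ ys) ≡ anyB f xs ∨ anyB f ys
anyB-++ f [] ys = refl
anyB-++ f (x ∷ xs) ys = trans (cong (f x ∨_) (anyB-++ f xs ys)) (sym (∨-assoc (f x) (anyB f xs) (anyB f ys)))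

module _ {A B : Set} {P : B → Set} {Q : A → Set} (P? : (b : B) → Dec (P b)) (Q? : (a : A) → Dec (Q a))
         {f : A → B} (P∘f≗Q : ∀ x → does (P? (f x)) ≡ does (Q? x)) where

  filter-map-compat : ∀ xs → filter P? (map f xs) ≡ map f (filter Q? xs)
  filter-map-compat [] = refl
  filter-map-compat (x ∷ xs) with does (P? (f x)) | does (Q? x) | P∘f≗Q x
  ... | true  | true  | refl = cong (f x ∷_) (filter-map-compat xs)
  ... | false | false | refl = filter-map-compat xs

module _ {A : Set} {P Q : A → Set} (P? : (a : A) → Dec (P a)) (Q? : (a : A) → Dec (Q a)) where

  filter-cong-local : ∀ {xs} → All (λ x → does (P? x) ≡ does (Q? x)) xs → filter P? xs ≡ filter Q? xs
  filter-cong-local {[]} [] = refl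
  filter-cong-local {x ∷ xs} (h ∷ hs) with does (P? x) | does (Q? x) | h
  ... | true  | true  | refl = cong (x ∷_) (filter-cong-local hs)
  ... | false | false | refl = filter-cong-local hs

-- After k growth steps every column lies in [-k, k]; the column j ∈ [0, 2k] stands for
-- column k j = j - k.  In these coordinates spreading at q keeps the columns ≤ q and moves
-- those > q by 2, and the new tiles of rgrow lie strictly between suc q and the special column.

column : ℕ → ℕ → ℤ
column K j = + j ℤ.- + K

PointN : Set
PointN = ℕ × ℕ

record NTiling : Set where
  constructor ntiling
  field
    lowerN    : List PointN
    tileListN : List (List PointN)
open NTiling

toPoint : ℕ → PointN → Point
toPoint K (j , y) = column K j , y

toTiling : ℕ → NTiling → Tiling
toTiling K T = tiling (map (toPoint K) (lowerN T)) (map (map (toPoint K)) (tileListN T))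

spreadPtN : ℕ → PointN → List PointN
spreadPtN q (j , y) =
  if ⌊ j ℕ.<? q ⌋ then (j , y) ∷ []
  else if ⌊ j ℕ.≟ q ⌋ then (j , y) ∷ (suc j , suc y) ∷ (suc (suc j) , y) ∷ []
  else (suc (suc j) , y) ∷ []

spreadPathN : ℕ → List PointN → List PointN
spreadPathN q = concatMap (spreadPtN q)

spreadN : ℕ → NTiling → NTiling
spreadN q T = ntiling (spreadPathN q (lowerN T)) (map (spreadPathN q) (tileListN T))

heightAtN : List PointN → ℕ → ℕ
heightAtN [] c = 0
heightAtN ((x , y) ∷ ps) c = if ⌊ x ℕ.≟ c ⌋ then y else heightAtN ps c

countAt : ℕ → List PointN → ℕ
countAt c P = length (filter (λ p → proj₁ p ℕ.≟ c) P)

boxesAtN : NTiling → ℕ → ℕ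
boxesAtN T c = countAt c (concat (tileListN T))

upperN : NTiling → ℕ → ℕ
upperN T c = heightAtN (lowerN T) c + 2 * boxesAtN T c

columnsN : NTiling → List ℕ
columnsN T = map proj₁ (lowerN T)

isOneBoxAtN : ℕ → ℕ → List PointN → Bool
isOneBoxAtN c y ((x , z) ∷ []) = ⌊ x ℕ.≟ c ⌋ ∧ ⌊ z ℕ.≟ y ⌋
isOneBoxAtN c y _ = false

isOneBoxBelowN : ℕ → ℕ → List PointN → Bool
isOneBoxBelowN c u t = anyB (λ y → isOneBoxAtN c y t ∧ ⌊ y + 2 ℕ.≟ u ⌋) (map proj₂ t)

eligibleN : NTiling → ℕ → Bool
eligibleN T c = ⌊ upperN T c ℕ.≟ suc (upperN T (pred c)) ⌋
                ∧ not (anyB (isOneBoxBelowN c (upperN T c)) (tileListN T))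

specialN : NTiling → Maybe ℕ
specialN T = last (filter (λ c → T? (eligibleN T c)) (drop 1 (columnsN T)))

fillColumnsN : NTiling → ℕ → ℕ → List ℕ
fillColumnsN T s Q = filter (λ c → s ℕ.<? c ×-dec c ℕ.<? Q) (columnsN T)

newTilesN : NTiling → ℕ → ℕ → List (List PointN)
newTilesN T s Q = map (λ c → (c , upperN T c) ∷ []) (fillColumnsN T s Q)

withNewTilesN : NTiling → ℕ → ℕ → NTiling
withNewTilesN T s Q = ntiling (lowerN T) (tileListN T ++ newTilesN T s Q)

fillToN : NTiling → ℕ → Maybe ℕ → NTiling
fillToN T s nothing = T
fillToN T s (just Q) = if ⌊ s ℕ.<? Q ⌋ then withNewTilesN T s Q else T

rgrowN : NTiling → ℕ → NTiling
rgrowN T q = fillToN (spreadN q T) (suc q) (specialN (spreadN q T))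

areaN : NTiling → ℕ
areaN T = length (concat (tileListN T))

tilesN : NTiling → ℕ
tilesN T = length (tileListN T)

DTRN : List ℕ → NTiling → NTiling
DTRN [] T = T
DTRN (x ∷ xs) T = DTRN xs (rgrowN T x)

emptyN : NTiling
emptyN = ntiling ((0 , 0) ∷ []) []

interval : ℕ → ℕ → List ℕ
interval a zero = []
interval a (suc n) = a ∷ interval (suc a) n

column≡⊖ : ∀ K a → column K a ≡ a ℤ.⊖ K
column≡⊖ K a = ℤₚ.m-n≡m⊖n a K

column-mono-< : ∀ K {a b} → a < b → column K a ℤ.< column K b
column-mono-< K {a} {b} a<b rewrite column≡⊖ K a | column≡⊖ K b = ℤₚ.⊖-monoˡ-< K a<b

column-mono-≤ : ∀ K {a b} → a ≤ b → column K a ℤ.≤ column K b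
column-mono-≤ K {a} {b} a≤b rewrite column≡⊖ K a | column≡⊖ K b = ℤₚ.⊖-monoˡ-≤ K a≤b

column-cancel-< : ∀ K {a b} → column K a ℤ.< column K b → a < b
column-cancel-< K {a} {b} lt with a ℕ.<? b
... | yes a<b = a<b
... | no a≮b = ⊥-elim (ℤₚ.≤⇒≯ (column-mono-≤ K (ℕₚ.≮⇒≥ a≮b)) lt)

column-injective : ∀ K {a b} → column K a ≡ column K b → a ≡ b
column-injective K {a} {b} eq = ℤₚ.+-injective (begin
  + a                    ≡⟨ sym (cancel (+ a) (+ K)) ⟩
  column K a ℤ.+ + K     ≡⟨ cong (ℤ._+ + K) eq ⟩
  column K b ℤ.+ + K     ≡⟨ cancel (+ b) (+ K) ⟩
  + b                    ∎)
  where
  open ≡-Reasoning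
  cancel : ∀ x y → (x ℤ.- y) ℤ.+ y ≡ x
  cancel = solve-∀

column-<⇔ : ∀ K a b → column K a ℤ.< column K b ⇔ a < b
column-<⇔ K a b = mk⇔ (column-cancel-< K) (column-mono-< K)

column-≡⇔ : ∀ K a b → column K a ≡ column K b ⇔ a ≡ b
column-≡⇔ K a b = mk⇔ (column-injective K) (cong (column K))

column-<? : ∀ K a b → ⌊ column K a ℤ.<? column K b ⌋ ≡ ⌊ a ℕ.<? b ⌋
column-<? K a b = isYes-⇔ (column-<⇔ K a b) _ _

column-≟ : ∀ K a b → ⌊ column K a ℤ.≟ column K b ⌋ ≡ ⌊ a ℕ.≟ b ⌋
column-≟ K a b = isYes-⇔ (column-≡⇔ K a b) _ _

column-left : ∀ K j → column K j ℤ.- 1ℤ ≡ column (suc K) j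
column-left K j = solve (+ j) (+ K)
  where solve : ∀ j k → (j ℤ.- k) ℤ.- 1ℤ ≡ j ℤ.- (1ℤ ℤ.+ k)
        solve = solve-∀

column-centre : ∀ K j → column K j ≡ column (suc K) (suc j)
column-centre K j = solve (+ j) (+ K)
  where solve : ∀ j k → j ℤ.- k ≡ (1ℤ ℤ.+ j) ℤ.- (1ℤ ℤ.+ k)
        solve = solve-∀

column-right : ∀ K j → column K j ℤ.+ 1ℤ ≡ column (suc K) (suc (suc j))
column-right K j = solve (+ j) (+ K)
  where solve : ∀ j k → (j ℤ.- k) ℤ.+ 1ℤ ≡ (1ℤ ℤ.+ (1ℤ ℤ.+ j)) ℤ.- (1ℤ ℤ.+ k)
        solve = solve-∀

column-pred : ∀ K j → column K (suc j) ℤ.- 1ℤ ≡ column K j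
column-pred K j = solve (+ j) (+ K)
  where solve : ∀ j k → ((1ℤ ℤ.+ j) ℤ.- k) ℤ.- 1ℤ ≡ j ℤ.- k
        solve = solve-∀

spreadPt-toPoint : ∀ K q j y →
  spreadPt (column K q) (column K j , y) ≡ map (toPoint (suc K)) (spreadPtN q (j , y))
spreadPt-toPoint K q j y rewrite column-<? K j q | column-≟ K j q with ⌊ j ℕ.<? q ⌋
... | true = cong (λ z → (z , y) ∷ []) (column-left K j)
... | false with ⌊ j ℕ.≟ q ⌋
...   | true = cong₂ (λ a b → (a , y) ∷ b) (column-left K j)
                 (cong₂ (λ a b → (a , suc y) ∷ b) (column-centre K j) (cong (λ z → (z , y) ∷ []) (column-right K j)))
...   | false = cong (λ z → (z , y) ∷ []) (column-right K j)

spreadPath-toPoint : ∀ K q P →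
  spreadPath (column K q) (map (toPoint K) P) ≡ map (toPoint (suc K)) (spreadPathN q P)
spreadPath-toPoint K q [] = refl
spreadPath-toPoint K q ((j , y) ∷ P) = begin
    spreadPt (column K q) (column K j , y) ++ spreadPath (column K q) (map (toPoint K) P)
  ≡⟨ cong₂ _++_ (spreadPt-toPoint K q j y) (spreadPath-toPoint K q P) ⟩
    map (toPoint (suc K)) (spreadPtN q (j , y)) ++ map (toPoint (suc K)) (spreadPathN q P)
  ≡⟨ sym (Listₚ.map-++ (toPoint (suc K)) (spreadPtN q (j , y)) (spreadPathN q P)) ⟩
    map (toPoint (suc K)) (spreadPathN q ((j , y) ∷ P)) ∎
  where open ≡-Reasoning

spread-toTiling : ∀ K q T → spread (column K q) (toTiling K T) ≡ toTiling (suc K) (spreadN q T)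
spread-toTiling K q T = cong₂ tiling (spreadPath-toPoint K q (lowerN T)) (paths (tileListN T))
  where
  paths : ∀ ts → map (spreadPath (column K q)) (map (map (toPoint K)) ts)
                 ≡ map (map (toPoint (suc K))) (map (spreadPathN q) ts)
  paths [] = refl
  paths (t ∷ ts) = cong₂ _∷_ (spreadPath-toPoint K q t) (paths ts)

heightAt-toPoint : ∀ K P c → heightAt (map (toPoint K) P) (column K c) ≡ heightAtN P c
heightAt-toPoint K [] c = refl
heightAt-toPoint K ((x , y) ∷ P) c rewrite column-≟ K x c with ⌊ x ℕ.≟ c ⌋
... | true = refl
... | false = heightAt-toPoint K P c

boxesAt-toTiling : ∀ K T c → boxesAt (toTiling K T) (column K c) ≡ boxesAtN T c
boxesAt-toTiling K T c = begin
    length (filter (λ p → proj₁ p ℤ.≟ column K c) (concat (map (map (toPoint K)) (tileListN T))))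
  ≡⟨ cong (λ ps → length (filter (λ p → proj₁ p ℤ.≟ column K c) ps)) (Listₚ.concat-map (tileListN T)) ⟩
    length (filter (λ p → proj₁ p ℤ.≟ column K c) (map (toPoint K) (concat (tileListN T))))
  ≡⟨ cong length (filter-map-compat (λ p → proj₁ p ℤ.≟ column K c) (λ p → proj₁ p ℕ.≟ c)
                   (λ p → does-⇔ (column-≡⇔ K (proj₁ p) c) (column K (proj₁ p) ℤ.≟ column K c) (proj₁ p ℕ.≟ c))
                   (concat (tileListN T))) ⟩
    length (map (toPoint K) (filter (λ p → proj₁ p ℕ.≟ c) (concat (tileListN T))))
  ≡⟨ Listₚ.length-map (toPoint K) (filter (λ p → proj₁ p ℕ.≟ c) (concat (tileListN T))) ⟩
    boxesAtN T c ∎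
  where open ≡-Reasoning

upper-toTiling : ∀ K T c → upper (toTiling K T) (column K c) ≡ upperN T c
upper-toTiling K T c = cong₂ (λ h b → h + 2 * b) (heightAt-toPoint K (lowerN T) c) (boxesAt-toTiling K T c)

isOneBoxBelow-toPoint : ∀ K c u t →
  anyB (λ y → isOneBoxAt (column K c) y (map (toPoint K) t) ∧ ⌊ y + 2 ℕ.≟ u ⌋) (map proj₂ (map (toPoint K) t))
  ≡ isOneBoxBelowN c u t
isOneBoxBelow-toPoint K c u [] = refl
isOneBoxBelow-toPoint K c u ((x , z) ∷ []) rewrite column-≟ K x c = refl
isOneBoxBelow-toPoint K c u (a ∷ b ∷ t) =
  trans (anyB-false (map proj₂ (map (toPoint K) (a ∷ b ∷ t)))) (sym (anyB-false (map proj₂ (a ∷ b ∷ t))))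

eligible-toTiling : ∀ K T c → eligible (toTiling K T) (column K (suc c)) ≡ eligibleN T (suc c)
eligible-toTiling K T c
  rewrite column-pred K c | upper-toTiling K T (suc c) | upper-toTiling K T c
        | anyB-map (λ t → anyB (λ y → isOneBoxAt (column K (suc c)) y t ∧ ⌊ y + 2 ℕ.≟ upperN T (suc c) ⌋)
                                (map proj₂ t)) (map (toPoint K)) (tileListN T)
        | anyB-cong (isOneBoxBelow-toPoint K (suc c) (upperN T (suc c))) (tileListN T) = refl

interval-suc : ∀ a n → interval (suc a) n ≡ map suc (interval a n)
interval-suc a zero = refl
interval-suc a (suc n) = cong (suc a ∷_) (interval-suc (suc a) n)

does-T? : ∀ b → does (T? b) ≡ b
does-T? true = refl
does-T? false = refl

columns-toTiling : ∀ K T → columns (toTiling K T) ≡ map (column K) (columnsN T)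
columns-toTiling K T = trans (sym (Listₚ.map-∘ (lowerN T))) (Listₚ.map-∘ (lowerN T))

special-toTiling : ∀ K T n → columnsN T ≡ interval 0 (suc n) →
  special (toTiling K T) ≡ Maybe.map (column K) (specialN T)
special-toTiling K T n cols = begin
    last (filter (λ c → T? (eligible (toTiling K T) c)) (drop 1 (columns (toTiling K T))))
  ≡⟨ cong (λ cs → last (filter (λ c → T? (eligible (toTiling K T) c)) cs)) inner≡ ⟩
    last (filter (λ c → T? (eligible (toTiling K T) c)) (map (λ x → column K (suc x)) (interval 0 n)))
  ≡⟨ cong last (filter-map-compat (λ c → T? (eligible (toTiling K T) c)) (λ c → T? (eligibleN T (suc c)))
       (λ x → trans (does-T? _) (trans (eligible-toTiling K T x) (sym (does-T? _)))) (interval 0 n)) ⟩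
    last (map (λ x → column K (suc x)) (filter (λ c → T? (eligibleN T (suc c))) (interval 0 n)))
  ≡⟨ cong last (Listₚ.map-∘ (filter (λ c → T? (eligibleN T (suc c))) (interval 0 n))) ⟩
    last (map (column K) (map suc (filter (λ c → T? (eligibleN T (suc c))) (interval 0 n))))
  ≡⟨ Listₚ.last-map (column K) (map suc (filter (λ c → T? (eligibleN T (suc c))) (interval 0 n))) ⟩
    Maybe.map (column K) (last (map suc (filter (λ c → T? (eligibleN T (suc c))) (interval 0 n))))
  ≡⟨ cong (λ cs → Maybe.map (column K) (last cs))
       (sym (filter-map-compat (λ c → T? (eligibleN T c)) (λ c → T? (eligibleN T (suc c))) (λ x → refl) (interval 0 n))) ⟩
    Maybe.map (column K) (last (filter (λ c → T? (eligibleN T c)) (map suc (interval 0 n))))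
  ≡⟨ cong (λ cs → Maybe.map (column K) (last (filter (λ c → T? (eligibleN T c)) cs)))
       (sym (trans (cong (drop 1) cols) (interval-suc 0 n))) ⟩
    Maybe.map (column K) (specialN T) ∎
  where
  open ≡-Reasoning
  inner≡ : drop 1 (columns (toTiling K T)) ≡ map (λ x → column K (suc x)) (interval 0 n)
  inner≡ = begin
    drop 1 (columns (toTiling K T))            ≡⟨ cong (drop 1) (trans (columns-toTiling K T) (cong (map (column K)) cols)) ⟩
    map (column K) (interval 1 n)              ≡⟨ cong (map (column K)) (interval-suc 0 n) ⟩
    map (column K) (map suc (interval 0 n))    ≡⟨ sym (Listₚ.map-∘ (interval 0 n)) ⟩
    map (λ x → column K (suc x)) (interval 0 n) ∎

-- The body of rgrow after its two with-abstractions.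
rgrowFill : Tiling → ℤ → Maybe ℤ → Tiling
rgrowFill T'' s nothing = T''
rgrowFill T'' s (just Q) =
  if ⌊ s ℤ.<? Q ⌋
  then tiling (lower T'')
         (tileList T'' ++
           map (λ c → (c , upper T'' c) ∷ []) (filter (λ c → s ℤ.<? c ×-dec c ℤ.<? Q) (columns T'')))
  else T''

rgrow≡rgrowFill : ∀ T s → rgrow T s ≡ rgrowFill (spread s T) s (special (spread s T))
rgrow≡rgrowFill T s with special (spread s T)
... | nothing = refl
... | just Q = refl

newTiles-toTiling : ∀ K T s Q →
  map (λ c → (c , upper (toTiling K T) c) ∷ [])
      (filter (λ c → column K s ℤ.<? c ×-dec c ℤ.<? column K Q) (columns (toTiling K T)))
  ≡ map (map (toPoint K)) (newTilesN T s Q)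
newTiles-toTiling K T s Q
  rewrite columns-toTiling K T
        | filter-map-compat (λ c → column K s ℤ.<? c ×-dec c ℤ.<? column K Q) (λ c → s ℕ.<? c ×-dec c ℕ.<? Q)
            (λ x → cong₂ _∧_ (does-⇔ (column-<⇔ K s x) (column K s ℤ.<? column K x) (s ℕ.<? x))
                             (does-⇔ (column-<⇔ K x Q) (column K x ℤ.<? column K Q) (x ℕ.<? Q)))
            (columnsN T)
  = singletons (fillColumnsN T s Q)
  where
  singletons : ∀ cs → map (λ c → (c , upper (toTiling K T) c) ∷ []) (map (column K) cs)
                      ≡ map (map (toPoint K)) (map (λ c → (c , upperN T c) ∷ []) cs)
  singletons [] = refl
  singletons (c ∷ cs) = cong₂ _∷_ (cong (λ u → (column K c , u) ∷ []) (upper-toTiling K T c)) (singletons cs)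

rgrowFill-toTiling : ∀ K T s mQ →
  rgrowFill (toTiling K T) (column K s) (Maybe.map (column K) mQ) ≡ toTiling K (fillToN T s mQ)
rgrowFill-toTiling K T s nothing = refl
rgrowFill-toTiling K T s (just Q) rewrite column-<? K s Q with ⌊ s ℕ.<? Q ⌋
... | false = refl
... | true = cong (tiling (map (toPoint K) (lowerN T)))
    (trans (cong (map (map (toPoint K)) (tileListN T) ++_) (newTiles-toTiling K T s Q))
           (sym (Listₚ.map-++ (map (toPoint K)) (tileListN T) (newTilesN T s Q))))

rgrow-toTiling : ∀ K T q n → columnsN (spreadN q T) ≡ interval 0 (suc n) →
  rgrow (toTiling K T) (column K q) ≡ toTiling (suc K) (rgrowN T q)
rgrow-toTiling K T q n cols = begin
    rgrow (toTiling K T) (column K q)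
  ≡⟨ rgrow≡rgrowFill (toTiling K T) (column K q) ⟩
    rgrowFill (spread (column K q) (toTiling K T)) (column K q) (special (spread (column K q) (toTiling K T)))
  ≡⟨ cong (λ T'' → rgrowFill T'' (column K q) (special T'')) (spread-toTiling K q T) ⟩
    rgrowFill S (column K q) (special S)
  ≡⟨ cong₂ (rgrowFill S) (column-centre K q) (special-toTiling (suc K) (spreadN q T) n cols) ⟩
    rgrowFill S (column (suc K) (suc q)) (Maybe.map (column (suc K)) (specialN (spreadN q T)))
  ≡⟨ rgrowFill-toTiling (suc K) (spreadN q T) (suc q) (specialN (spreadN q T)) ⟩
    toTiling (suc K) (rgrowN T q) ∎
  where
  open ≡-Reasoning
  S = toTiling (suc K) (spreadN q T)

area-toTiling : ∀ K T → area (toTiling K T) ≡ areaN T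
area-toTiling K T = trans (cong length (Listₚ.concat-map (tileListN T))) (Listₚ.length-map (toPoint K) (concat (tileListN T)))

tiles-toTiling : ∀ K T → tiles (toTiling K T) ≡ tilesN T
tiles-toTiling K T = Listₚ.length-map (map (toPoint K)) (tileListN T)

spreadPtN-< : ∀ {q x} y → x < q → spreadPtN q (x , y) ≡ (x , y) ∷ []
spreadPtN-< {q} {x} y x<q rewrite isYes-true (x ℕ.<? q) x<q = refl

spreadPtN-≡ : ∀ q y → spreadPtN q (q , y) ≡ (q , y) ∷ (suc q , suc y) ∷ (suc (suc q) , y) ∷ []
spreadPtN-≡ q y rewrite isYes-false (q ℕ.<? q) (ℕₚ.<-irrefl refl) | ≟-refl q = refl

spreadPtN-> : ∀ {q x} y → q < x → spreadPtN q (x , y) ≡ (suc (suc x) , y) ∷ []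
spreadPtN-> {q} {x} y q<x rewrite isYes-false (x ℕ.<? q) (ℕₚ.<⇒≯ q<x) | ≟-> q<x = refl

-- Column j of the spread at q lies over column (unspread q j) of the original tiling;
-- both new columns suc q and suc (suc q) lie over q.
unspread : ℕ → ℕ → ℕ
unspread q j = if ⌊ j ℕ.≤? q ⌋ then j else if ⌊ j ℕ.≤? suc (suc q) ⌋ then q else j ∸ 2

data SpreadColumn (q : ℕ) : ℕ → Set where
  before : ∀ {j} → j ≤ q → SpreadColumn q j
  middle : SpreadColumn q (suc q)
  copy   : SpreadColumn q (suc (suc q))
  after  : ∀ {j} → q < j → SpreadColumn q (suc (suc j))

spreadColumn : ∀ q j → SpreadColumn q j
spreadColumn q zero = before z≤n
spreadColumn q (suc j) with ℕₚ.<-cmp j q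
... | tri< j<q _ _ = before j<q
... | tri≈ _ refl _ = middle
... | tri> _ _ q<j = copyOrAfter q<j
  where
  copyOrAfter : ∀ {q j} → q < j → SpreadColumn q (suc j)
  copyOrAfter {q} {suc j′} (s≤s q≤j′) with ℕₚ.m≤n⇒m<n∨m≡n q≤j′
  ... | inj₁ q<j′ = after q<j′
  ... | inj₂ refl = copy

unspread-before : ∀ {q j} → j ≤ q → unspread q j ≡ j
unspread-before {q} {j} j≤q rewrite isYes-true (j ℕ.≤? q) j≤q = refl

unspread-middle : ∀ q → unspread q (suc q) ≡ q
unspread-middle q rewrite isYes-false (suc q ℕ.≤? q) ℕₚ.1+n≰n
                        | isYes-true (suc q ℕ.≤? suc (suc q)) (ℕₚ.n≤1+n (suc q)) = refl

unspread-copy : ∀ q → unspread q (suc (suc q)) ≡ q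
unspread-copy q rewrite isYes-false (suc (suc q) ℕ.≤? q) (ℕₚ.<⇒≱ (ℕₚ.m<n+m q (s≤s z≤n)))
                      | isYes-true (suc (suc q) ℕ.≤? suc (suc q)) ℕₚ.≤-refl = refl

unspread-after : ∀ {q j} → q < j → unspread q (suc (suc j)) ≡ j
unspread-after {q} {j} q<j
  rewrite isYes-false (suc (suc j) ℕ.≤? q) (ℕₚ.<⇒≱ (ℕₚ.<-trans q<j (ℕₚ.m<n+m j (s≤s z≤n))))
        | isYes-false (suc (suc j) ℕ.≤? suc (suc q)) (λ le → ℕₚ.<⇒≱ q<j (ℕₚ.≤-pred (ℕₚ.≤-pred le))) = refl

private
  ≤⇒<2+ : ∀ {a b} → a ≤ b → a < suc (suc b)
  ≤⇒<2+ a≤b = s≤s (ℕₚ.m≤n⇒m≤1+n a≤b)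

  ≤⇒≤2+ : ∀ {a b} → a ≤ b → a ≤ suc (suc b)
  ≤⇒≤2+ a≤b = ℕₚ.m≤n⇒m≤1+n (ℕₚ.m≤n⇒m≤1+n a≤b)

heightAtN-spread-before : ∀ q P j → j ≤ q → heightAtN (spreadPathN q P) j ≡ heightAtN P j
heightAtN-spread-before q [] j j≤q = refl
heightAtN-spread-before q ((x , y) ∷ P) j j≤q with ℕₚ.<-cmp x q
... | tri< x<q _ _ rewrite spreadPtN-< {q} y x<q =
  cong (λ h → if ⌊ x ℕ.≟ j ⌋ then y else h) (heightAtN-spread-before q P j j≤q)
... | tri≈ _ refl _ rewrite spreadPtN-≡ x y with ⌊ x ℕ.≟ j ⌋
...   | true = refl
...   | false rewrite ≟-> (s≤s j≤q) | ≟-> (≤⇒<2+ j≤q) = heightAtN-spread-before x P j j≤q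
heightAtN-spread-before q ((x , y) ∷ P) j j≤q | tri> _ _ q<x
  rewrite spreadPtN-> {q} y q<x | ≟-> {suc (suc x)} {j} (ℕₚ.≤-trans (≤⇒<2+ j≤q) (s≤s (s≤s (ℕₚ.<⇒≤ q<x))))
        | ≟-> {x} {j} (ℕₚ.≤-<-trans j≤q q<x) = heightAtN-spread-before q P j j≤q

heightAtN-spread-middle : ∀ q P → Any (λ p → proj₁ p ≡ q) P → heightAtN (spreadPathN q P) (suc q) ≡ suc (heightAtN P q)
heightAtN-spread-middle q ((x , y) ∷ P) q∈P with ℕₚ.<-cmp x q
... | tri< x<q _ _ rewrite spreadPtN-< {q} y x<q | ≟-< {x} {suc q} (ℕₚ.m≤n⇒m≤1+n x<q) | ≟-< x<q with q∈P
...   | here x≡q = ⊥-elim (ℕₚ.<⇒≢ x<q x≡q)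
...   | there q∈P′ = heightAtN-spread-middle q P q∈P′
heightAtN-spread-middle q ((x , y) ∷ P) q∈P | tri≈ _ refl _
  rewrite spreadPtN-≡ x y | ≟-< {x} {suc x} ℕₚ.≤-refl | ≟-refl (suc x) | ≟-refl x = refl
heightAtN-spread-middle q ((x , y) ∷ P) q∈P | tri> _ _ q<x
  rewrite spreadPtN-> {q} y q<x | ≟-> {suc (suc x)} {suc q} (s≤s (ℕₚ.m≤n⇒m≤1+n q<x)) | ≟-> q<x with q∈P
...   | here x≡q = ⊥-elim (ℕₚ.>⇒≢ q<x x≡q)
...   | there q∈P′ = heightAtN-spread-middle q P q∈P′

heightAtN-spread-copy : ∀ q P → heightAtN (spreadPathN q P) (suc (suc q)) ≡ heightAtN P q
heightAtN-spread-copy q [] = refl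
heightAtN-spread-copy q ((x , y) ∷ P) with ℕₚ.<-cmp x q
... | tri< x<q _ _ rewrite spreadPtN-< {q} y x<q | ≟-< {x} {suc (suc q)} (≤⇒<2+ (ℕₚ.<⇒≤ x<q)) | ≟-< x<q =
  heightAtN-spread-copy q P
... | tri≈ _ refl _ rewrite spreadPtN-≡ x y | ≟-< {x} {suc (suc x)} (ℕₚ.n≤1+n (suc x))
                          | ≟-< {suc x} {suc (suc x)} ℕₚ.≤-refl | ≟-refl (suc (suc x)) | ≟-refl x = refl
... | tri> _ _ q<x rewrite spreadPtN-> {q} y q<x | ≟-suc-suc x q | ≟-> q<x = heightAtN-spread-copy q P

heightAtN-spread-after : ∀ q P j → q < j → heightAtN (spreadPathN q P) (suc (suc j)) ≡ heightAtN P j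
heightAtN-spread-after q [] j q<j = refl
heightAtN-spread-after q ((x , y) ∷ P) j q<j with ℕₚ.<-cmp x q
... | tri< x<q _ _ rewrite spreadPtN-< {q} y x<q | ≟-< {x} {suc (suc j)} (≤⇒<2+ (ℕₚ.<⇒≤ (ℕₚ.<-trans x<q q<j)))
                         | ≟-< (ℕₚ.<-trans x<q q<j) = heightAtN-spread-after q P j q<j
... | tri≈ _ refl _ rewrite spreadPtN-≡ x y | ≟-< {x} {suc (suc j)} (≤⇒<2+ (ℕₚ.<⇒≤ q<j))
                          | ≟-< {suc x} {suc (suc j)} (s≤s (ℕₚ.m≤n⇒m≤1+n q<j)) | ≟-suc-suc x j | ≟-< q<j =
  heightAtN-spread-after x P j q<j
... | tri> _ _ q<x rewrite spreadPtN-> {q} y q<x | ≟-suc-suc x j =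
  cong (λ h → if ⌊ x ℕ.≟ j ⌋ then y else h) (heightAtN-spread-after q P j q<j)

hits : ℕ → PointN → ℕ
hits j (x , y) = if ⌊ x ℕ.≟ j ⌋ then 1 else 0

hitCount : ℕ → List PointN → ℕ
hitCount j [] = 0
hitCount j (p ∷ P) = hits j p + hitCount j P

length-filter-∷ : ∀ {A : Set} {P : A → Set} (P? : (a : A) → Dec (P a)) x xs →
  length (filter P? (x ∷ xs)) ≡ (if does (P? x) then 1 else 0) + length (filter P? xs)
length-filter-∷ P? x xs with does (P? x)
... | true = refl
... | false = refl

countAt≡hitCount : ∀ j P → countAt j P ≡ hitCount j P
countAt≡hitCount j [] = refl
countAt≡hitCount j ((x , y) ∷ P) = trans (length-filter-∷ (λ p → proj₁ p ℕ.≟ j) (x , y) P)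
  (cong₂ _+_ (cong (λ b → if b then 1 else 0) (sym (isYes≗does (x ℕ.≟ j)))) (countAt≡hitCount j P))

hitCount-++ : ∀ j xs ys → hitCount j (xs ++ ys) ≡ hitCount j xs + hitCount j ys
hitCount-++ j [] ys = refl
hitCount-++ j (p ∷ xs) ys =
  trans (cong (λ n → hits j p + n) (hitCount-++ j xs ys)) (sym (ℕₚ.+-assoc (hits j p) (hitCount j xs) (hitCount j ys)))

hitCount-spreadPt : ∀ q j x y → hitCount j (spreadPtN q (x , y)) ≡ hits (unspread q j) (x , y)
hitCount-spreadPt q j x y with spreadColumn q j | ℕₚ.<-cmp x q
... | before j≤q | tri< x<q _ _ rewrite unspread-before j≤q | spreadPtN-< {q} y x<q = ℕₚ.+-identityʳ _
... | before j≤q | tri≈ _ refl _ rewrite unspread-before j≤q | spreadPtN-≡ x y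
      | ≟-> {suc x} {j} (s≤s j≤q) | ≟-> {suc (suc x)} {j} (≤⇒<2+ j≤q) = ℕₚ.+-identityʳ _
... | before j≤q | tri> _ _ q<x rewrite unspread-before j≤q | spreadPtN-> {q} y q<x
      | ≟-> {suc (suc x)} {j} (ℕₚ.≤-trans (s≤s j≤q) (≤⇒≤2+ q<x)) | ≟-> {x} {j} (ℕₚ.≤-<-trans j≤q q<x) = refl
... | middle | tri< x<q _ _ rewrite unspread-middle q | spreadPtN-< {q} y x<q
      | ≟-< {x} {suc q} (ℕₚ.m≤n⇒m≤1+n x<q) | ≟-< x<q = refl
... | middle | tri≈ _ refl _ rewrite unspread-middle x | spreadPtN-≡ x y | ≟-< {x} {suc x} ℕₚ.≤-refl
      | ≟-refl (suc x) | ≟-> {suc (suc x)} {suc x} ℕₚ.≤-refl | ≟-refl x = refl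
... | middle | tri> _ _ q<x rewrite unspread-middle q | spreadPtN-> {q} y q<x
      | ≟-> {suc (suc x)} {suc q} (s≤s (ℕₚ.m≤n⇒m≤1+n q<x)) | ≟-> q<x = refl
... | copy | tri< x<q _ _ rewrite unspread-copy q | spreadPtN-< {q} y x<q
      | ≟-< {x} {suc (suc q)} (≤⇒≤2+ x<q) | ≟-< x<q = refl
... | copy | tri≈ _ refl _ rewrite unspread-copy x | spreadPtN-≡ x y | ≟-< {x} {suc (suc x)} (ℕₚ.n≤1+n (suc x))
      | ≟-< {suc x} {suc (suc x)} ℕₚ.≤-refl | ≟-refl (suc (suc x)) | ≟-refl x = refl
... | copy | tri> _ _ q<x rewrite unspread-copy q | spreadPtN-> {q} y q<x | ≟-suc-suc x q | ≟-> q<x = refl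
... | after {j′} q<j′ | tri< x<q _ _ rewrite unspread-after q<j′ | spreadPtN-< {q} y x<q
      | ≟-< {x} {suc (suc j′)} (≤⇒≤2+ (ℕₚ.<-trans x<q q<j′)) | ≟-< (ℕₚ.<-trans x<q q<j′) = refl
... | after {j′} q<j′ | tri≈ _ refl _ rewrite unspread-after q<j′ | spreadPtN-≡ x y
      | ≟-< {x} {suc (suc j′)} (≤⇒≤2+ q<j′) | ≟-< {suc x} {suc (suc j′)} (s≤s (ℕₚ.m≤n⇒m≤1+n q<j′))
      | ≟-suc-suc x j′ | ≟-< q<j′ = refl
... | after {j′} q<j′ | tri> _ _ q<x rewrite unspread-after q<j′ | spreadPtN-> {q} y q<x | ≟-suc-suc x j′ =
  ℕₚ.+-identityʳ _

hitCount-spread : ∀ q j P → hitCount j (spreadPathN q P) ≡ hitCount (unspread q j) P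
hitCount-spread q j [] = refl
hitCount-spread q j ((x , y) ∷ P) =
  trans (hitCount-++ j (spreadPtN q (x , y)) (spreadPathN q P))
        (cong₂ _+_ (hitCount-spreadPt q j x y) (hitCount-spread q j P))

length-spreadPt : ∀ q x y → length (spreadPtN q (x , y)) ≡ 1 + 2 * hits q (x , y)
length-spreadPt q x y with ℕₚ.<-cmp x q
... | tri< x<q _ _ rewrite spreadPtN-< {q} y x<q | ≟-< x<q = refl
... | tri≈ _ refl _ rewrite spreadPtN-≡ x y | ≟-refl x = refl
... | tri> _ _ q<x rewrite spreadPtN-> {q} y q<x | ≟-> q<x = refl

length-spread : ∀ q P → length (spreadPathN q P) ≡ length P + 2 * hitCount q P
length-spread q [] = refl
length-spread q ((x , y) ∷ P) = begin
    length (spreadPtN q (x , y) ++ spreadPathN q P)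
  ≡⟨ Listₚ.length-++ (spreadPtN q (x , y)) ⟩
    length (spreadPtN q (x , y)) + length (spreadPathN q P)
  ≡⟨ cong₂ _+_ (length-spreadPt q x y) (length-spread q P) ⟩
    1 + 2 * hits q (x , y) + (length P + 2 * hitCount q P)
  ≡⟨ solve (hits q (x , y)) (length P) (hitCount q P) ⟩
    1 + length P + 2 * (hits q (x , y) + hitCount q P) ∎
  where
  open ≡-Reasoning
  solve : ∀ h l c → 1 + 2 * h + (l + 2 * c) ≡ 1 + l + 2 * (h + c)
  solve = ℕ-Solver.solve-∀

concat-spread : ∀ q ts → concat (map (spreadPathN q) ts) ≡ spreadPathN q (concat ts)
concat-spread q [] = refl
concat-spread q (t ∷ ts) =
  trans (cong (spreadPathN q t ++_) (concat-spread q ts)) (sym (Listₚ.concatMap-++ (spreadPtN q) t (concat ts)))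

boxesAtN-spread : ∀ q T j → boxesAtN (spreadN q T) j ≡ boxesAtN T (unspread q j)
boxesAtN-spread q T j = begin
  countAt j (concat (map (spreadPathN q) (tileListN T)))   ≡⟨ countAt≡hitCount j (concat (map (spreadPathN q) (tileListN T))) ⟩
  hitCount j (concat (map (spreadPathN q) (tileListN T)))  ≡⟨ cong (hitCount j) (concat-spread q (tileListN T)) ⟩
  hitCount j (spreadPathN q (concat (tileListN T)))        ≡⟨ hitCount-spread q j (concat (tileListN T)) ⟩
  hitCount (unspread q j) (concat (tileListN T))           ≡⟨ sym (countAt≡hitCount (unspread q j) (concat (tileListN T))) ⟩
  boxesAtN T (unspread q j)                                ∎
  where open ≡-Reasoning

areaN-spread : ∀ q T → areaN (spreadN q T) ≡ areaN T + 2 * boxesAtN T q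
areaN-spread q T = begin
  length (concat (map (spreadPathN q) (tileListN T)))        ≡⟨ cong length (concat-spread q (tileListN T)) ⟩
  length (spreadPathN q (concat (tileListN T)))              ≡⟨ length-spread q (concat (tileListN T)) ⟩
  areaN T + 2 * hitCount q (concat (tileListN T))            ≡⟨ cong (λ c → areaN T + 2 * c)
                                                                   (sym (countAt≡hitCount q (concat (tileListN T)))) ⟩
  areaN T + 2 * boxesAtN T q                                 ∎
  where open ≡-Reasoning

tilesN-spread : ∀ q T → tilesN (spreadN q T) ≡ tilesN T
tilesN-spread q T = Listₚ.length-map (spreadPathN q) (tileListN T)

upperN-spread-before : ∀ q T j → j ≤ q → upperN (spreadN q T) j ≡ upperN T j
upperN-spread-before q T j j≤q
  rewrite heightAtN-spread-before q (lowerN T) j j≤q | boxesAtN-spread q T j | unspread-before j≤q = refl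

upperN-spread-middle : ∀ q T → Any (λ p → proj₁ p ≡ q) (lowerN T) → upperN (spreadN q T) (suc q) ≡ suc (upperN T q)
upperN-spread-middle q T q∈T
  rewrite heightAtN-spread-middle q (lowerN T) q∈T | boxesAtN-spread q T (suc q) | unspread-middle q = refl

upperN-spread-copy : ∀ q T → upperN (spreadN q T) (suc (suc q)) ≡ upperN T q
upperN-spread-copy q T
  rewrite heightAtN-spread-copy q (lowerN T) | boxesAtN-spread q T (suc (suc q)) | unspread-copy q = refl

upperN-spread-after : ∀ q T j → q < j → upperN (spreadN q T) (suc (suc j)) ≡ upperN T j
upperN-spread-after q T j q<j
  rewrite heightAtN-spread-after q (lowerN T) j q<j | boxesAtN-spread q T (suc (suc j)) | unspread-after q<j = refl

isOneBoxBelowN-multi : ∀ c u a b t → isOneBoxBelowN c u (a ∷ b ∷ t) ≡ false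
isOneBoxBelowN-multi c u a b t = anyB-false (map proj₂ (a ∷ b ∷ t))

isOneBoxBelowN-single : ∀ c u x z → isOneBoxBelowN c u ((x , z) ∷ []) ≡ ⌊ x ℕ.≟ c ⌋ ∧ ⌊ z + 2 ℕ.≟ u ⌋
isOneBoxBelowN-single c u x z =
  trans (∨-identityʳ _) (cong (_∧ ⌊ z + 2 ℕ.≟ u ⌋) (trans (cong (⌊ x ℕ.≟ c ⌋ ∧_) (≟-refl z)) (∧-identityʳ _)))

spreadPtN-nonempty : ∀ q p → Σ[ h ∈ PointN ] Σ[ r ∈ List PointN ] spreadPtN q p ≡ h ∷ r
spreadPtN-nonempty q (x , y) with ℕₚ.<-cmp x q
... | tri< x<q _ _ = _ , _ , spreadPtN-< {q} y x<q
... | tri≈ _ refl _ = _ , _ , spreadPtN-≡ x y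
... | tri> _ _ q<x = _ , _ , spreadPtN-> {q} y q<x

isOneBoxBelowN-spread-multi : ∀ q c u a b t → isOneBoxBelowN c u (spreadPathN q (a ∷ b ∷ t)) ≡ false
isOneBoxBelowN-spread-multi q c u a b t
  with spreadPtN-nonempty q a | spreadPtN-nonempty q b
... | h , r , a≡ | h′ , r′ , b≡ rewrite a≡ | b≡ with r
...   | [] = isOneBoxBelowN-multi c u h h′ (r′ ++ spreadPathN q t)
...   | v ∷ w = isOneBoxBelowN-multi c u h v (w ++ h′ ∷ r′ ++ spreadPathN q t)

isOneBoxBelowN-spread-after : ∀ q j u t → q < j →
  isOneBoxBelowN (suc (suc j)) u (spreadPathN q t) ≡ isOneBoxBelowN j u t
isOneBoxBelowN-spread-after q j u [] q<j = refl
isOneBoxBelowN-spread-after q j u ((x , z) ∷ []) q<j with ℕₚ.<-cmp x q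
... | tri< x<q _ _ rewrite spreadPtN-< {q} z x<q | isOneBoxBelowN-single (suc (suc j)) u x z
      | isOneBoxBelowN-single j u x z | ≟-< {x} {suc (suc j)} (≤⇒≤2+ (ℕₚ.<-trans x<q q<j))
      | ≟-< (ℕₚ.<-trans x<q q<j) = refl
... | tri≈ _ refl _ rewrite spreadPtN-≡ x z | isOneBoxBelowN-single j u x z | ≟-< q<j =
  isOneBoxBelowN-multi (suc (suc j)) u (x , z) (suc x , suc z) ((suc (suc x) , z) ∷ [])
... | tri> _ _ q<x rewrite spreadPtN-> {q} z q<x | isOneBoxBelowN-single (suc (suc j)) u (suc (suc x)) z
      | isOneBoxBelowN-single j u x z | ≟-suc-suc x j = refl
isOneBoxBelowN-spread-after q j u (a ∷ b ∷ t) q<j =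
  trans (isOneBoxBelowN-spread-multi q _ u a b t) (sym (isOneBoxBelowN-multi j u a b t))

isOneBoxBelowN-spread-middle : ∀ q u t → isOneBoxBelowN (suc q) u (spreadPathN q t) ≡ false
isOneBoxBelowN-spread-middle q u [] = refl
isOneBoxBelowN-spread-middle q u ((x , z) ∷ []) with ℕₚ.<-cmp x q
... | tri< x<q _ _ rewrite spreadPtN-< {q} z x<q | isOneBoxBelowN-single (suc q) u x z
      | ≟-< {x} {suc q} (ℕₚ.m≤n⇒m≤1+n x<q) = refl
... | tri≈ _ refl _ rewrite spreadPtN-≡ x z =
  isOneBoxBelowN-multi (suc x) u (x , z) (suc x , suc z) ((suc (suc x) , z) ∷ [])
... | tri> _ _ q<x rewrite spreadPtN-> {q} z q<x | isOneBoxBelowN-single (suc q) u (suc (suc x)) z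
      | ≟-> {suc (suc x)} {suc q} (s≤s (ℕₚ.m≤n⇒m≤1+n q<x)) = refl
isOneBoxBelowN-spread-middle q u (a ∷ b ∷ t) = isOneBoxBelowN-spread-multi q _ u a b t

anyOneBoxBelowN-spread-after : ∀ q j u ts → q < j →
  anyB (isOneBoxBelowN (suc (suc j)) u) (map (spreadPathN q) ts) ≡ anyB (isOneBoxBelowN j u) ts
anyOneBoxBelowN-spread-after q j u ts q<j =
  trans (anyB-map _ _ ts) (anyB-cong (λ t → isOneBoxBelowN-spread-after q j u t q<j) ts)

anyOneBoxBelowN-spread-middle : ∀ q u ts → anyB (isOneBoxBelowN (suc q) u) (map (spreadPathN q) ts) ≡ false
anyOneBoxBelowN-spread-middle q u ts =
  trans (anyB-map _ _ ts) (trans (anyB-cong (isOneBoxBelowN-spread-middle q u) ts) (anyB-false ts))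

eligibleN-spread-after : ∀ q T j → q < j → eligibleN (spreadN q T) (suc (suc j)) ≡ eligibleN T j
eligibleN-spread-after q T (suc j) q<j with ℕₚ.<-cmp q j
... | tri≈ _ refl _ rewrite upperN-spread-after q T (suc q) q<j | upperN-spread-copy q T
      | anyOneBoxBelowN-spread-after q (suc q) (upperN T (suc q)) (tileListN T) q<j = refl
... | tri< q<j′ _ _ rewrite upperN-spread-after q T (suc j) q<j | upperN-spread-after q T j q<j′
      | anyOneBoxBelowN-spread-after q (suc j) (upperN T (suc j)) (tileListN T) q<j = refl
... | tri> _ _ j<q = ⊥-elim (ℕₚ.<⇒≱ j<q (ℕₚ.≤-pred q<j))

eligibleN-spread-middle : ∀ q T → Any (λ p → proj₁ p ≡ q) (lowerN T) → eligibleN (spreadN q T) (suc q) ≡ true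
eligibleN-spread-middle q T q∈T
  rewrite upperN-spread-middle q T q∈T | upperN-spread-before q T q ℕₚ.≤-refl | ≟-refl (suc (upperN T q))
        | anyOneBoxBelowN-spread-middle q (suc (upperN T q)) (tileListN T) = refl

eligibleN-spread-copy : ∀ q T → Any (λ p → proj₁ p ≡ q) (lowerN T) → eligibleN (spreadN q T) (suc (suc q)) ≡ false
eligibleN-spread-copy q T q∈T
  rewrite upperN-spread-copy q T | upperN-spread-middle q T q∈T
        | ≟-< {upperN T q} {suc (suc (upperN T q))} (ℕₚ.n≤1+n _) = refl

private
  +-suc-≤ : ∀ {j} b n → j ≤ suc b + n → j ≤ b + suc n
  +-suc-≤ b n le = ℕₚ.≤-trans le (ℕₚ.≤-reflexive (sym (ℕₚ.+-suc b n)))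

  ≤-+-suc : ∀ {j} b n → j ≤ b + suc n → j ≤ suc b + n
  ≤-+-suc b n le = ℕₚ.≤-trans le (ℕₚ.≤-reflexive (ℕₚ.+-suc b n))

  interval-empty : ∀ {b q} → b ≤ q → ¬ (q < b + 0)
  interval-empty {b} b≤q q<b = ℕₚ.<⇒≱ q<b (ℕₚ.≤-trans (ℕₚ.≤-reflexive (ℕₚ.+-identityʳ b)) b≤q)

columns-spread-after : ∀ q P b n → map proj₁ P ≡ interval b n → q < b →
  map proj₁ (spreadPathN q P) ≡ interval (suc (suc b)) n
columns-spread-after q [] b zero cols q<b = refl
columns-spread-after q ((x , y) ∷ P) b (suc n) cols q<b with Listₚ.∷-injective cols
... | refl , cols′ rewrite spreadPtN-> {q} y q<b =
  cong (suc (suc x) ∷_) (columns-spread-after q P (suc x) n cols′ (ℕₚ.m≤n⇒m≤1+n q<b))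

columns-spread : ∀ q P b n → map proj₁ P ≡ interval b n → b ≤ q → q < b + n →
  map proj₁ (spreadPathN q P) ≡ interval b (suc (suc n))
columns-spread q [] b zero cols b≤q q<b+n = ⊥-elim (interval-empty b≤q q<b+n)
columns-spread q ((x , y) ∷ P) b (suc n) cols b≤q q<b+n with Listₚ.∷-injective cols
... | refl , cols′ with ℕₚ.<-cmp x q
...   | tri< x<q _ _ rewrite spreadPtN-< {q} y x<q =
  cong (x ∷_) (columns-spread q P (suc x) n cols′ x<q (≤-+-suc x n q<b+n))
...   | tri≈ _ refl _ rewrite spreadPtN-≡ x y =
  cong (λ cs → x ∷ suc x ∷ suc (suc x) ∷ cs) (columns-spread-after x P (suc x) n cols′ ℕₚ.≤-refl)
...   | tri> _ _ q<x = ⊥-elim (ℕₚ.<⇒≱ q<x b≤q)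

∈-columns : ∀ q (P : List PointN) b n → map proj₁ P ≡ interval b n → b ≤ q → q < b + n → Any (λ p → proj₁ p ≡ q) P
∈-columns q [] b zero cols b≤q q<b+n = ⊥-elim (interval-empty b≤q q<b+n)
∈-columns q ((x , y) ∷ P) b (suc n) cols b≤q q<b+n with Listₚ.∷-injective cols
... | refl , cols′ with ℕₚ.<-cmp x q
...   | tri≈ _ x≡q _ = here x≡q
...   | tri< x<q _ _ = there (∈-columns q P (suc x) n cols′ x<q (≤-+-suc x n q<b+n))
...   | tri> _ _ q<x = ⊥-elim (ℕₚ.<⇒≱ q<x b≤q)

filter-interval-none : ∀ (P : ℕ → Bool) n b → (∀ j → b ≤ j → j < b + n → P j ≡ false) →
  filter (λ c → T? (P c)) (interval b n) ≡ []
filter-interval-none P zero b none = refl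
filter-interval-none P (suc n) b none
  with P b | none b ℕₚ.≤-refl (+-suc-≤ b n (s≤s (ℕₚ.m≤m+n b n)))
... | false | refl = filter-interval-none P n (suc b) (λ j b<j j<b+n → none j (ℕₚ.<⇒≤ b<j) (+-suc-≤ b n j<b+n))

last-filter-interval : ∀ (P : ℕ → Bool) n b Q → b ≤ Q → Q < b + n → P Q ≡ true →
  (∀ j → Q < j → j < b + n → P j ≡ false) → last (filter (λ c → T? (P c)) (interval b n)) ≡ just Q
last-filter-interval P zero b Q b≤Q Q<b+n PQ none = ⊥-elim (interval-empty b≤Q Q<b+n)
last-filter-interval P (suc n) b Q b≤Q Q<b+n PQ none with ℕₚ.<-cmp b Q
... | tri≈ _ refl _ rewrite PQ
      | filter-interval-none P n (suc b) (λ j b<j j<b+n → none j b<j (+-suc-≤ b n j<b+n)) = refl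
... | tri> _ _ Q<b = ⊥-elim (ℕₚ.<⇒≱ Q<b b≤Q)
... | tri< b<Q _ _ with P b | last-filter-interval P n (suc b) Q b<Q (≤-+-suc b n Q<b+n) PQ
                                (λ j Q<j j<b+n → none j Q<j (+-suc-≤ b n j<b+n))
...   | false | ih = ih
...   | true  | ih = last-∷ b (filter (λ c → T? (P c)) (interval (suc b) n)) ih
  where
  last-∷ : ∀ {A : Set} (x : A) xs {Q} → last xs ≡ just Q → last (x ∷ xs) ≡ just Q
  last-∷ x (_ ∷ _) eq = eq

indicator : ∀ {P : Set} → Dec P → ℕ
indicator p = if does p then 1 else 0

occurrences : ℕ → List ℕ → ℕ
occurrences j [] = 0
occurrences j (c ∷ cs) = (if ⌊ c ℕ.≟ j ⌋ then 1 else 0) + occurrences j cs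

module _ {P : ℕ → Set} (P? : (c : ℕ) → Dec (P c)) where

  private
    occurrences-filter-skip : ∀ j x xs → x ≢ j → occurrences j (filter P? (x ∷ xs)) ≡ occurrences j (filter P? xs)
    occurrences-filter-skip j x xs x≢j with does (P? x)
    ... | true rewrite isYes-false (x ℕ.≟ j) x≢j = refl
    ... | false = refl

    occurrences-filter-below : ∀ j n b → j < b → occurrences j (filter P? (interval b n)) ≡ 0
    occurrences-filter-below j zero b j<b = refl
    occurrences-filter-below j (suc n) b j<b =
      trans (occurrences-filter-skip j b (interval (suc b) n) (ℕₚ.>⇒≢ j<b))
            (occurrences-filter-below j n (suc b) (ℕₚ.m≤n⇒m≤1+n j<b))

  occurrences-filter-rejected : ∀ j → does (P? j) ≡ false → ∀ xs → occurrences j (filter P? xs) ≡ 0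
  occurrences-filter-rejected j ¬Pj [] = refl
  occurrences-filter-rejected j ¬Pj (x ∷ xs) with x ℕ.≟ j
  ... | yes refl rewrite ¬Pj = occurrences-filter-rejected j ¬Pj xs
  ... | no x≢j = trans (occurrences-filter-skip j x xs x≢j) (occurrences-filter-rejected j ¬Pj xs)

  occurrences-filter-interval : ∀ j → does (P? j) ≡ true → ∀ n b → b ≤ j → j < b + n →
    occurrences j (filter P? (interval b n)) ≡ 1
  occurrences-filter-interval j Pj zero b b≤j j<b+n =
    ⊥-elim (ℕₚ.<⇒≱ j<b+n (ℕₚ.≤-trans (ℕₚ.≤-reflexive (ℕₚ.+-identityʳ b)) b≤j))
  occurrences-filter-interval j Pj (suc n) b b≤j j<b+n with ℕₚ.<-cmp b j
  ... | tri≈ _ refl _ rewrite Pj | ≟-refl b = cong suc (occurrences-filter-below b n (suc b) ℕₚ.≤-refl)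
  ... | tri< b<j _ _ = trans (occurrences-filter-skip j b (interval (suc b) n) (ℕₚ.<⇒≢ b<j))
      (occurrences-filter-interval j Pj n (suc b) b<j (ℕₚ.≤-trans j<b+n (ℕₚ.≤-reflexive (ℕₚ.+-suc b n))))
  ... | tri> _ _ j<b = ⊥-elim (ℕₚ.<⇒≱ j<b b≤j)

occurrences-between : ∀ s Q j n → j < n →
  occurrences j (filter (λ c → s ℕ.<? c ×-dec c ℕ.<? Q) (interval 0 n)) ≡ indicator (s ℕ.<? j ×-dec j ℕ.<? Q)
occurrences-between s Q j n j<n with does (s ℕ.<? j ×-dec j ℕ.<? Q) in eq
... | true = occurrences-filter-interval (λ c → s ℕ.<? c ×-dec c ℕ.<? Q) j eq n 0 z≤n j<n
... | false = occurrences-filter-rejected (λ c → s ℕ.<? c ×-dec c ℕ.<? Q) j eq (interval 0 n)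

length-between : ∀ s Q n b → Q ≤ b + n →
  length (filter (λ c → s ℕ.<? c ×-dec c ℕ.<? Q) (interval b n)) ≡ Q ∸ (b ⊔ suc s)
length-between s Q zero b Q≤b = sym (ℕₚ.m≤n⇒m∸n≡0
  (ℕₚ.≤-trans Q≤b (ℕₚ.≤-trans (ℕₚ.≤-reflexive (ℕₚ.+-identityʳ b)) (ℕₚ.m≤m⊔n b (suc s)))))
length-between s Q (suc n) b Q≤b+n
  with does (s ℕ.<? b ×-dec b ℕ.<? Q) in eq
     | length-between s Q n (suc b) (ℕₚ.≤-trans Q≤b+n (ℕₚ.≤-reflexive (ℕₚ.+-suc b n)))
... | true | ih with does-sound (s ℕ.<? b ×-dec b ℕ.<? Q) eq
...   | s<b , b<Q rewrite ih | ℕₚ.m≥n⇒m⊔n≡m {b} {suc s} s<b | ℕₚ.m≥n⇒m⊔n≡m {suc b} {suc s} (ℕₚ.m≤n⇒m≤1+n s<b) =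
  sym (ℕₚ.+-∸-assoc 1 b<Q)
length-between s Q (suc n) b Q≤b+n | false | ih rewrite ih with s ℕ.<? b
... | no s≮b rewrite ℕₚ.m≤n⇒m⊔n≡n {b} {suc s} (ℕₚ.≤-trans (ℕₚ.≮⇒≥ s≮b) (ℕₚ.n≤1+n s))
                   | ℕₚ.m≤n⇒m⊔n≡n {suc b} {suc s} (s≤s (ℕₚ.≮⇒≥ s≮b)) = refl
... | yes s<b rewrite ℕₚ.m≥n⇒m⊔n≡m {b} {suc s} s<b | ℕₚ.m≥n⇒m⊔n≡m {suc b} {suc s} (ℕₚ.m≤n⇒m≤1+n s<b)
  with b ℕ.<? Q
...   | yes b<Q = ⊥-elim (not-¬ {false} refl (trans (sym eq) (dec-true (s ℕ.<? b ×-dec b ℕ.<? Q) (s<b , b<Q))))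
...   | no b≮Q rewrite ℕₚ.m≤n⇒m∸n≡0 {Q} {b} (ℕₚ.≮⇒≥ b≮Q) =
  ℕₚ.m≤n⇒m∸n≡0 (ℕₚ.≤-trans (ℕₚ.≮⇒≥ b≮Q) (ℕₚ.n≤1+n b))

hitCount-singletons : ∀ (f : ℕ → ℕ) j cs → hitCount j (concat (map (λ c → (c , f c) ∷ []) cs)) ≡ occurrences j cs
hitCount-singletons f j [] = refl
hitCount-singletons f j (c ∷ cs) = cong (λ n → (if ⌊ c ℕ.≟ j ⌋ then 1 else 0) + n) (hitCount-singletons f j cs)

length-singletons : ∀ (f : ℕ → ℕ) cs → length (concat (map (λ c → (c , f c) ∷ []) cs)) ≡ length cs
length-singletons f [] = refl
length-singletons f (c ∷ cs) = cong suc (length-singletons f cs)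

boxesAtN-withNewTiles : ∀ T s Q j → boxesAtN (withNewTilesN T s Q) j ≡ boxesAtN T j + occurrences j (fillColumnsN T s Q)
boxesAtN-withNewTiles T s Q j = begin
    countAt j (concat (tileListN T ++ newTilesN T s Q))
  ≡⟨ countAt≡hitCount j (concat (tileListN T ++ newTilesN T s Q)) ⟩
    hitCount j (concat (tileListN T ++ newTilesN T s Q))
  ≡⟨ cong (hitCount j) (sym (Listₚ.concat-++ (tileListN T) (newTilesN T s Q))) ⟩
    hitCount j (concat (tileListN T) ++ concat (newTilesN T s Q))
  ≡⟨ hitCount-++ j (concat (tileListN T)) (concat (newTilesN T s Q)) ⟩
    hitCount j (concat (tileListN T)) + hitCount j (concat (newTilesN T s Q))
  ≡⟨ cong₂ _+_ (sym (countAt≡hitCount j (concat (tileListN T)))) (hitCount-singletons (upperN T) j (fillColumnsN T s Q)) ⟩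
    boxesAtN T j + occurrences j (fillColumnsN T s Q) ∎
  where open ≡-Reasoning

upperN-withNewTiles : ∀ T s Q j → upperN (withNewTilesN T s Q) j ≡ upperN T j + 2 * occurrences j (fillColumnsN T s Q)
upperN-withNewTiles T s Q j rewrite boxesAtN-withNewTiles T s Q j
  | ℕₚ.*-distribˡ-+ 2 (boxesAtN T j) (occurrences j (fillColumnsN T s Q)) =
  sym (ℕₚ.+-assoc (heightAtN (lowerN T) j) (2 * boxesAtN T j) (2 * occurrences j (fillColumnsN T s Q)))

areaN-withNewTiles : ∀ T s Q → areaN (withNewTilesN T s Q) ≡ areaN T + length (fillColumnsN T s Q)
areaN-withNewTiles T s Q rewrite sym (Listₚ.concat-++ (tileListN T) (newTilesN T s Q))
  | Listₚ.length-++ (concat (tileListN T)) {concat (newTilesN T s Q)}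
  | length-singletons (upperN T) (fillColumnsN T s Q) = refl

tilesN-withNewTiles : ∀ T s Q → tilesN (withNewTilesN T s Q) ≡ tilesN T + length (fillColumnsN T s Q)
tilesN-withNewTiles T s Q = trans (Listₚ.length-++ (tileListN T))
  (cong (λ n → tilesN T + n) (Listₚ.length-map (λ c → (c , upperN T c) ∷ []) (fillColumnsN T s Q)))

anyOneBoxBelow-singletons-absent : ∀ (f : ℕ → ℕ) j u cs → occurrences j cs ≡ 0 →
  anyB (isOneBoxBelowN j u) (map (λ c → (c , f c) ∷ []) cs) ≡ false
anyOneBoxBelow-singletons-absent f j u [] _ = refl
anyOneBoxBelow-singletons-absent f j u (c ∷ cs) none rewrite isOneBoxBelowN-single j u c (f c) with ⌊ c ℕ.≟ j ⌋
... | false = anyOneBoxBelow-singletons-absent f j u cs none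

anyOneBoxBelow-singletons-present : ∀ (f : ℕ → ℕ) j u cs → 1 ≤ occurrences j cs → f j + 2 ≡ u →
  anyB (isOneBoxBelowN j u) (map (λ c → (c , f c) ∷ []) cs) ≡ true
anyOneBoxBelow-singletons-present f j u (c ∷ cs) some fj+2≡u rewrite isOneBoxBelowN-single j u c (f c) with c ℕ.≟ j
... | yes refl rewrite fj+2≡u | ≟-refl u = refl
... | no _ = anyOneBoxBelow-singletons-present f j u cs some fj+2≡u

eligibleN-withNewTiles-outside : ∀ T s Q j → occurrences j (fillColumnsN T s Q) ≡ 0 →
  occurrences (pred j) (fillColumnsN T s Q) ≡ 0 → eligibleN (withNewTilesN T s Q) j ≡ eligibleN T j
eligibleN-withNewTiles-outside T s Q j j∉ pred-j∉
  rewrite upperN-withNewTiles T s Q j | upperN-withNewTiles T s Q (pred j) | j∉ | pred-j∉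
        | ℕₚ.+-identityʳ (upperN T j) | ℕₚ.+-identityʳ (upperN T (pred j))
        | anyB-++ (isOneBoxBelowN j (upperN T j)) (tileListN T) (newTilesN T s Q)
        | anyOneBoxBelow-singletons-absent (upperN T) j (upperN T j) (fillColumnsN T s Q) j∉
        | ∨-identityʳ (anyB (isOneBoxBelowN j (upperN T j)) (tileListN T)) = refl

-- A filled column is the top of its own new one-box tile.
eligibleN-withNewTiles-filled : ∀ T s Q j → occurrences j (fillColumnsN T s Q) ≡ 1 →
  eligibleN (withNewTilesN T s Q) j ≡ false
eligibleN-withNewTiles-filled T s Q j j∈ =
  trans (cong (λ b → ⌊ upperN T′ j ℕ.≟ suc (upperN T′ (pred j)) ⌋ ∧ not b)
          (trans (anyB-++ (isOneBoxBelowN j (upperN T′ j)) (tileListN T) (newTilesN T s Q))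
            (trans (cong (anyB (isOneBoxBelowN j (upperN T′ j)) (tileListN T) ∨_)
                     (anyOneBoxBelow-singletons-present (upperN T) j (upperN T′ j) (fillColumnsN T s Q)
                       (ℕₚ.≤-reflexive (sym j∈)) top))
                   (∨-zeroʳ _))))
        (∧-zeroʳ _)
  where
  T′ = withNewTilesN T s Q
  top : upperN T j + 2 ≡ upperN T′ j
  top = sym (trans (upperN-withNewTiles T s Q j) (cong (λ n → upperN T j + 2 * n) j∈))

-- Filling the column left of an up step turns it into a level step.
eligibleN-withNewTiles-after-filled : ∀ T s Q j → occurrences j (fillColumnsN T s Q) ≡ 0 →
  occurrences (pred j) (fillColumnsN T s Q) ≡ 1 → eligibleN T j ≡ true → eligibleN (withNewTilesN T s Q) j ≡ false
eligibleN-withNewTiles-after-filled T s Q j j∉ pred-j∈ j-eligible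
  rewrite upperN-withNewTiles T s Q j | upperN-withNewTiles T s Q (pred j) | j∉ | pred-j∈ | ℕₚ.+-identityʳ (upperN T j)
        | isYes-sound (upperN T j ℕ.≟ suc (upperN T (pred j))) (∧-conicalˡ _ _ j-eligible)
        | ≟-< {suc (upperN T (pred j))} {suc (upperN T (pred j) + 2)}
              (s≤s (ℕₚ.≤-trans (ℕₚ.n≤1+n _) (ℕₚ.≤-reflexive (ℕₚ.+-comm 2 (upperN T (pred j)))))) = refl

-- T has the columns 0, …, 2m and a is its rightmost eligible column (a = 0: there is none).
record GrowthShape (m a : ℕ) (T : NTiling) : Set where
  field
    columns≡         : columnsN T ≡ interval 0 (suc (2 * m))
    a≤2m             : a ≤ 2 * m
    ineligible-right : ∀ j → a < j → j ≤ 2 * m → eligibleN T j ≡ false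
    eligible-a       : 1 ≤ a → eligibleN T a ≡ true
open GrowthShape

-- The special column of the spread at q is suc (suc a) if q < a and suc q otherwise,
-- so rgrowN fills the a ∸ q columns strictly between suc q and suc (suc a).
record GrowthStep (m a q : ℕ) (T : NTiling) : Set where
  field
    shape′ : GrowthShape (suc m) (suc q) (rgrowN T q)
    boxes′ : ∀ j → j ≤ 2 * suc m →
             boxesAtN (rgrowN T q) j ≡ boxesAtN T (unspread q j) + indicator (suc q ℕ.<? j ×-dec j ℕ.<? suc (suc a))
    area′  : areaN (rgrowN T q) ≡ areaN T + 2 * boxesAtN T q + (a ∸ q)
    tiles′ : tilesN (rgrowN T q) ≡ tilesN T + (a ∸ q)
open GrowthStep

2*suc : ∀ m → 2 * suc m ≡ suc (suc (2 * m))
2*suc m = ℕₚ.*-suc 2 m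

module GrowthStepProof (m a : ℕ) (T : NTiling) (G : GrowthShape m a T) (q : ℕ) (q≤2m : q ≤ 2 * m) where

  S = spreadN q T

  columns-S : columnsN S ≡ interval 0 (suc (suc (suc (2 * m))))
  columns-S = columns-spread q (lowerN T) 0 (suc (2 * m)) (columns≡ G) z≤n (s≤s q≤2m)

  columns-S′ : columnsN S ≡ interval 0 (suc (2 * suc m))
  columns-S′ = trans columns-S (cong (λ n → interval 0 (suc n)) (sym (2*suc m)))

  q∈T : Any (λ p → proj₁ p ≡ q) (lowerN T)
  q∈T = ∈-columns q (lowerN T) 0 (suc (2 * m)) (columns≡ G) z≤n (s≤s q≤2m)

  special-S : ∀ Q → 1 ≤ Q → Q ≤ suc (suc (2 * m)) → eligibleN S Q ≡ true →
    (∀ j → Q < j → j ≤ suc (suc (2 * m)) → eligibleN S j ≡ false) → specialN S ≡ just Q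
  special-S Q 1≤Q Q≤ eligible-Q ineligible rewrite columns-S =
    last-filter-interval (eligibleN S) (suc (suc (2 * m))) 1 Q 1≤Q (s≤s Q≤) eligible-Q
      (λ j Q<j j< → ineligible j Q<j (ℕₚ.≤-pred j<))

  suc-q≤2m+2 : suc q ≤ 2 * suc m
  suc-q≤2m+2 = ℕₚ.≤-trans (s≤s (ℕₚ.m≤n⇒m≤1+n q≤2m)) (ℕₚ.≤-reflexive (sym (2*suc m)))

  module Case-q<a (q<a : q < a) where

    eligible-a+2 : eligibleN S (suc (suc a)) ≡ true
    eligible-a+2 = trans (eligibleN-spread-after q T a q<a) (eligible-a G (ℕₚ.≤-trans (s≤s z≤n) q<a))

    ineligible-after-a+2 : ∀ j → suc (suc a) < j → j ≤ suc (suc (2 * m)) → eligibleN S j ≡ false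
    ineligible-after-a+2 (suc zero) (s≤s ()) _
    ineligible-after-a+2 (suc (suc j)) a+2<j j≤ =
      trans (eligibleN-spread-after q T j (ℕₚ.<-trans q<a (ℕₚ.≤-pred (ℕₚ.≤-pred a+2<j))))
            (ineligible-right G j (ℕₚ.≤-pred (ℕₚ.≤-pred a+2<j)) (ℕₚ.≤-pred (ℕₚ.≤-pred j≤)))

    rgrow≡ : rgrowN T q ≡ withNewTilesN S (suc q) (suc (suc a))
    rgrow≡ rewrite special-S (suc (suc a)) (s≤s z≤n) (s≤s (s≤s (a≤2m G))) eligible-a+2 ineligible-after-a+2
                 | isYes-true (suc q ℕ.<? suc (suc a)) (s≤s (ℕₚ.m≤n⇒m≤1+n q<a)) = refl

    F = fillColumnsN S (suc q) (suc (suc a))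

    between? : (c : ℕ) → Dec (suc q < c × c < suc (suc a))
    between? c = suc q ℕ.<? c ×-dec c ℕ.<? suc (suc a)

    occurrences-F : ∀ j → j ≤ suc (suc (2 * m)) → occurrences j F ≡ indicator (between? j)
    occurrences-F j j≤ rewrite columns-S = occurrences-between (suc q) (suc (suc a)) j (suc (suc (suc (2 * m)))) (s≤s j≤)

    outside-F : ∀ j → ¬ (suc q < j × j < suc (suc a)) → occurrences j F ≡ 0
    outside-F j ¬between = occurrences-filter-rejected between? j (dec-false (between? j) ¬between) (columnsN S)

    inside-F : ∀ j → suc q < j → j < suc (suc a) → occurrences j F ≡ 1
    inside-F j q+1<j j<a+2 = trans (occurrences-F j (ℕₚ.≤-trans (ℕₚ.<⇒≤ j<a+2) (s≤s (s≤s (a≤2m G)))))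
                                   (cong (λ b → if b then 1 else 0) (dec-true (between? j) (q+1<j , j<a+2)))

    length-F : length F ≡ a ∸ q
    length-F rewrite columns-S =
      length-between (suc q) (suc (suc a)) (suc (suc (suc (2 * m)))) 0 (s≤s (s≤s (ℕₚ.m≤n⇒m≤1+n (a≤2m G))))

    ineligible-right′ : ∀ j → suc q < j → j ≤ suc (suc (2 * m)) → eligibleN (withNewTilesN S (suc q) (suc (suc a))) j ≡ false
    ineligible-right′ j q+1<j j≤ with ℕₚ.<-cmp j (suc (suc a))
    ... | tri< j<a+2 _ _ = eligibleN-withNewTiles-filled S (suc q) (suc (suc a)) j (inside-F j q+1<j j<a+2)
    ... | tri≈ _ refl _ = eligibleN-withNewTiles-after-filled S (suc q) (suc (suc a)) j
                            (outside-F j (λ p → ℕₚ.<-irrefl refl (proj₂ p))) (inside-F (suc a) (s≤s q<a) ℕₚ.≤-refl) eligible-a+2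
    ... | tri> _ _ a+2<j = trans (eligibleN-withNewTiles-outside S (suc q) (suc (suc a)) j
                                   (outside-F j (λ p → ℕₚ.<-asym a+2<j (proj₂ p)))
                                   (outside-F (pred j) (λ p → ℕₚ.<⇒≱ (proj₂ p) (a+2≤pred a+2<j))))
                                 (ineligible-after-a+2 j a+2<j j≤)
      where
      a+2≤pred : ∀ {j} → suc (suc a) < j → suc (suc a) ≤ pred j
      a+2≤pred {suc j} a+2<j = ℕₚ.≤-pred a+2<j

    step : GrowthStep m a q T
    step = record
      { shape′ = record
          { columns≡ = trans (cong columnsN rgrow≡) columns-S′
          ; a≤2m = suc-q≤2m+2
          ; ineligible-right = λ j q+1<j j≤ → trans (cong (λ T′ → eligibleN T′ j) rgrow≡)
                                 (ineligible-right′ j q+1<j (ℕₚ.≤-trans j≤ (ℕₚ.≤-reflexive (2*suc m))))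
          ; eligible-a = λ _ → trans (cong (λ T′ → eligibleN T′ (suc q)) rgrow≡)
              (trans (eligibleN-withNewTiles-outside S (suc q) (suc (suc a)) (suc q)
                        (outside-F (suc q) (λ p → ℕₚ.<-irrefl refl (proj₁ p)))
                        (outside-F q (λ p → ℕₚ.<-asym (ℕₚ.n<1+n q) (proj₁ p))))
                     (eligibleN-spread-middle q T q∈T))
          }
      ; boxes′ = λ j j≤ → trans (cong (λ T′ → boxesAtN T′ j) rgrow≡)
          (trans (boxesAtN-withNewTiles S (suc q) (suc (suc a)) j)
                 (cong₂ _+_ (boxesAtN-spread q T j) (occurrences-F j (ℕₚ.≤-trans j≤ (ℕₚ.≤-reflexive (2*suc m))))))
      ; area′ = trans (cong areaN rgrow≡)
          (trans (areaN-withNewTiles S (suc q) (suc (suc a))) (cong₂ _+_ (areaN-spread q T) length-F))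
      ; tiles′ = trans (cong tilesN rgrow≡)
          (trans (tilesN-withNewTiles S (suc q) (suc (suc a))) (cong₂ _+_ (tilesN-spread q T) length-F))
      }

  module Case-a≤q (a≤q : a ≤ q) where

    eligible-q+1 : eligibleN S (suc q) ≡ true
    eligible-q+1 = eligibleN-spread-middle q T q∈T

    ineligible-after-q+1 : ∀ j → suc q < j → j ≤ suc (suc (2 * m)) → eligibleN S j ≡ false
    ineligible-after-q+1 (suc zero) (s≤s ()) _
    ineligible-after-q+1 (suc (suc j)) q+1<j j≤ with ℕₚ.<-cmp q j
    ... | tri≈ _ refl _ = eligibleN-spread-copy q T q∈T
    ... | tri< q<j _ _ = trans (eligibleN-spread-after q T j q<j)
                               (ineligible-right G j (ℕₚ.≤-<-trans a≤q q<j) (ℕₚ.≤-pred (ℕₚ.≤-pred j≤)))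
    ... | tri> _ _ j<q = ⊥-elim (ℕₚ.<⇒≱ j<q (ℕₚ.≤-pred (ℕₚ.≤-pred q+1<j)))

    rgrow≡ : rgrowN T q ≡ S
    rgrow≡ rewrite special-S (suc q) (s≤s z≤n) (s≤s (ℕₚ.m≤n⇒m≤1+n q≤2m)) eligible-q+1 ineligible-after-q+1
                 | isYes-false (suc q ℕ.<? suc q) (ℕₚ.<-irrefl refl) = refl

    nothing-between : ∀ j → indicator (suc q ℕ.<? j ×-dec j ℕ.<? suc (suc a)) ≡ 0
    nothing-between j = cong (λ b → if b then 1 else 0) (dec-false (suc q ℕ.<? j ×-dec j ℕ.<? suc (suc a))
      (λ p → ℕₚ.<⇒≱ (proj₂ p) (ℕₚ.≤-trans (s≤s (s≤s a≤q)) (proj₁ p))))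

    a∸q≡0 : a ∸ q ≡ 0
    a∸q≡0 = ℕₚ.m≤n⇒m∸n≡0 a≤q

    step : GrowthStep m a q T
    step = record
      { shape′ = record
          { columns≡ = trans (cong columnsN rgrow≡) columns-S′
          ; a≤2m = suc-q≤2m+2
          ; ineligible-right = λ j q+1<j j≤ → trans (cong (λ T′ → eligibleN T′ j) rgrow≡)
                                 (ineligible-after-q+1 j q+1<j (ℕₚ.≤-trans j≤ (ℕₚ.≤-reflexive (2*suc m))))
          ; eligible-a = λ _ → trans (cong (λ T′ → eligibleN T′ (suc q)) rgrow≡) eligible-q+1
          }
      ; boxes′ = λ j _ → trans (cong (λ T′ → boxesAtN T′ j) rgrow≡)
          (trans (boxesAtN-spread q T j) (sym (trans (cong (λ n → boxesAtN T (unspread q j) + n) (nothing-between j))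
                                                     (ℕₚ.+-identityʳ _))))
      ; area′ = trans (cong areaN rgrow≡) (trans (areaN-spread q T)
          (sym (trans (cong (λ n → areaN T + 2 * boxesAtN T q + n) a∸q≡0) (ℕₚ.+-identityʳ _))))
      ; tiles′ = trans (cong tilesN rgrow≡) (trans (tilesN-spread q T)
          (sym (trans (cong (λ n → tilesN T + n) a∸q≡0) (ℕₚ.+-identityʳ _))))
      }

growthStep : ∀ m a T q → GrowthShape m a T → q ≤ 2 * m → GrowthStep m a q T
growthStep m a T q G q≤2m with q ℕ.<? a
... | yes q<a = GrowthStepProof.Case-q<a.step m a T G q q≤2m q<a
... | no q≮a = GrowthStepProof.Case-a≤q.step m a T G q q≤2m (ℕₚ.≮⇒≥ q≮a)

growthShape-empty : GrowthShape 0 0 emptyN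
growthShape-empty = record
  { columns≡ = refl
  ; a≤2m = z≤n
  ; ineligible-right = λ j 0<j j≤0 → ⊥-elim (ℕₚ.<⇒≱ 0<j j≤0)
  ; eligible-a = λ ()
  }

-- The position of the letter at position x once UD has been inserted after the first q letters.
shift : ℕ → ℕ → ℕ
shift q x = if ⌊ x ℕ.≤? q ⌋ then x else suc (suc x)

shift-≤ : ∀ {q x} → x ≤ q → shift q x ≡ x
shift-≤ {q} {x} x≤q rewrite isYes-true (x ℕ.≤? q) x≤q = refl

shift-> : ∀ {q x} → q < x → shift q x ≡ suc (suc x)
shift-> {q} {x} q<x rewrite isYes-false (x ℕ.≤? q) (ℕₚ.<⇒≱ q<x) = refl

data ShiftCase (q x : ℕ) : Set where
  unmoved : x ≤ q → shift q x ≡ x → ShiftCase q x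
  moved   : q < x → shift q x ≡ suc (suc x) → ShiftCase q x

shiftCase : ∀ q x → ShiftCase q x
shiftCase q x with x ℕ.≤? q
... | yes x≤q = unmoved x≤q (shift-≤ x≤q)
... | no x≰q = moved (ℕₚ.≰⇒> x≰q) (shift-> (ℕₚ.≰⇒> x≰q))

private
  ≤-2+ : ∀ {a} → a ≤ suc (suc a)
  ≤-2+ = ℕₚ.≤-trans (ℕₚ.n≤1+n _) (ℕₚ.n≤1+n _)

shift-<-⇔ : ∀ q a b → shift q a < shift q b ⇔ a < b
shift-<-⇔ q a b with shiftCase q a | shiftCase q b
... | unmoved a≤q sa | unmoved b≤q sb rewrite sa | sb = mk⇔ (λ a<b → a<b) (λ a<b → a<b)
... | unmoved a≤q sa | moved q<b sb rewrite sa | sb =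
  mk⇔ (λ _ → ℕₚ.≤-<-trans a≤q q<b) (λ _ → ℕₚ.≤-trans (s≤s a≤q) (ℕₚ.≤-trans q<b ≤-2+))
... | moved q<a sa | unmoved b≤q sb rewrite sa | sb =
  mk⇔ (λ a+2<b → ⊥-elim (ℕₚ.<⇒≱ (ℕₚ.<-≤-trans a+2<b b≤q) (ℕₚ.≤-trans (ℕₚ.<⇒≤ q<a) ≤-2+)))
      (λ a<b → ⊥-elim (ℕₚ.<⇒≱ (ℕₚ.<-≤-trans a<b b≤q) (ℕₚ.<⇒≤ q<a)))
... | moved q<a sa | moved q<b sb rewrite sa | sb = mk⇔ (λ lt → ℕₚ.≤-pred (ℕₚ.≤-pred lt)) (λ lt → s≤s (s≤s lt))

shift-<-suc-⇔ : ∀ q R → shift q R < suc q ⇔ R ≤ q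
shift-<-suc-⇔ q R with shiftCase q R
... | unmoved R≤q sR rewrite sR = mk⇔ ℕₚ.≤-pred s≤s
... | moved q<R sR rewrite sR =
  mk⇔ (λ lt → ⊥-elim (ℕₚ.<⇒≱ lt (ℕₚ.≤-trans q<R ≤-2+))) (λ R≤q → ⊥-elim (ℕₚ.<⇒≱ q<R R≤q))

suc-<-shift-⇔ : ∀ q A → suc q < shift q A ⇔ q < A
suc-<-shift-⇔ q A with shiftCase q A
... | unmoved A≤q sA rewrite sA =
  mk⇔ (λ lt → ⊥-elim (ℕₚ.<⇒≱ lt (ℕₚ.≤-trans A≤q (ℕₚ.n≤1+n q)))) (λ q<A → ⊥-elim (ℕₚ.<⇒≱ q<A A≤q))
... | moved q<A sA rewrite sA = mk⇔ (λ _ → q<A) (λ q<A → s≤s (s≤s (ℕₚ.<⇒≤ q<A)))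

shift-≤-⇔ : ∀ q R j → shift q R ≤ j ⇔ R ≤ unspread q j
shift-≤-⇔ q R j with spreadColumn q j | shiftCase q R
... | before j≤q | unmoved R≤q sR rewrite sR | unspread-before j≤q = mk⇔ (λ le → le) (λ le → le)
... | before j≤q | moved q<R sR rewrite sR | unspread-before j≤q =
  mk⇔ (λ le → ⊥-elim (ℕₚ.<⇒≱ q<R (ℕₚ.≤-trans (ℕₚ.≤-trans ≤-2+ le) j≤q)))
      (λ le → ⊥-elim (ℕₚ.<⇒≱ q<R (ℕₚ.≤-trans le j≤q)))
... | middle | unmoved R≤q sR rewrite sR | unspread-middle q = mk⇔ (λ _ → R≤q) (λ _ → ℕₚ.m≤n⇒m≤1+n R≤q)
... | middle | moved q<R sR rewrite sR | unspread-middle q =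
  mk⇔ (λ le → ⊥-elim (ℕₚ.<⇒≱ q<R (ℕₚ.≤-pred (ℕₚ.m≤n⇒m≤1+n (ℕₚ.≤-pred le)))))
      (λ le → ⊥-elim (ℕₚ.<⇒≱ q<R le))
... | copy | unmoved R≤q sR rewrite sR | unspread-copy q = mk⇔ (λ _ → R≤q) (λ _ → ℕₚ.≤-trans R≤q ≤-2+)
... | copy | moved q<R sR rewrite sR | unspread-copy q =
  mk⇔ (λ le → ℕₚ.≤-pred (ℕₚ.≤-pred le)) (λ le → ⊥-elim (ℕₚ.<⇒≱ q<R le))
... | after {j′} q<j′ | unmoved R≤q sR rewrite sR | unspread-after q<j′ =
  mk⇔ (λ _ → ℕₚ.≤-trans R≤q (ℕₚ.<⇒≤ q<j′)) (λ le → ℕₚ.≤-trans le ≤-2+)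
... | after {j′} q<j′ | moved q<R sR rewrite sR | unspread-after q<j′ =
  mk⇔ (λ le → ℕₚ.≤-pred (ℕₚ.≤-pred le)) (λ le → s≤s (s≤s le))

<-shift-⇔ : ∀ q A j → j < shift q A ⇔ unspread q j < A
<-shift-⇔ q A j with spreadColumn q j | shiftCase q A
... | before j≤q | unmoved A≤q sA rewrite sA | unspread-before j≤q = mk⇔ (λ lt → lt) (λ lt → lt)
... | before j≤q | moved q<A sA rewrite sA | unspread-before j≤q =
  mk⇔ (λ _ → ℕₚ.≤-<-trans j≤q q<A) (λ _ → ℕₚ.≤-trans (s≤s (ℕₚ.≤-trans j≤q (ℕₚ.<⇒≤ q<A))) (ℕₚ.n≤1+n _))
... | middle | unmoved A≤q sA rewrite sA | unspread-middle q =
  mk⇔ (λ lt → ⊥-elim (ℕₚ.<⇒≱ lt (ℕₚ.m≤n⇒m≤1+n A≤q))) (λ lt → ⊥-elim (ℕₚ.<⇒≱ lt A≤q))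
... | middle | moved q<A sA rewrite sA | unspread-middle q = mk⇔ (λ _ → q<A) (λ lt → s≤s (ℕₚ.m≤n⇒m≤1+n lt))
... | copy | unmoved A≤q sA rewrite sA | unspread-copy q =
  mk⇔ (λ lt → ⊥-elim (ℕₚ.<⇒≱ lt (ℕₚ.≤-trans A≤q ≤-2+))) (λ lt → ⊥-elim (ℕₚ.<⇒≱ lt A≤q))
... | copy | moved q<A sA rewrite sA | unspread-copy q = mk⇔ (λ _ → q<A) (λ lt → s≤s (s≤s lt))
... | after {j′} q<j′ | unmoved A≤q sA rewrite sA | unspread-after q<j′ =
  mk⇔ (λ lt → ⊥-elim (ℕₚ.<⇒≱ (ℕₚ.≤-<-trans A≤q q<j′) (ℕₚ.≤-trans ≤-2+ (ℕₚ.<⇒≤ lt))))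
      (λ lt → ⊥-elim (ℕₚ.<⇒≱ (ℕₚ.≤-<-trans A≤q q<j′) (ℕₚ.<⇒≤ lt)))
... | after {j′} q<j′ | moved q<A sA rewrite sA | unspread-after q<j′ =
  mk⇔ (λ lt → ℕₚ.≤-pred (ℕₚ.≤-pred lt)) (λ lt → s≤s (s≤s lt))

-- Inserting UD after the first q letters widens every chord around position q by 2.
shift-difference : ∀ q R A → R < A →
  + shift q A ℤ.- + shift q R ≡ (+ A ℤ.- + R) ℤ.+ + (2 * indicator (R ℕ.≤? q ×-dec q ℕ.<? A))
shift-difference q R A R<A with shiftCase q R | shiftCase q A
... | unmoved R≤q sR | unmoved A≤q sA
  rewrite sR | sA | dec-false (R ℕ.≤? q ×-dec q ℕ.<? A) (λ p → ℕₚ.<⇒≱ (proj₂ p) A≤q) = solve (+ A) (+ R)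
  where solve : ∀ a b → a ℤ.- b ≡ (a ℤ.- b) ℤ.+ 0ℤ
        solve = solve-∀
... | unmoved R≤q sR | moved q<A sA rewrite sR | sA | dec-true (R ℕ.≤? q ×-dec q ℕ.<? A) (R≤q , q<A) = solve (+ A) (+ R)
  where solve : ∀ a b → (+ 2 ℤ.+ a) ℤ.- b ≡ (a ℤ.- b) ℤ.+ + 2
        solve = solve-∀
... | moved q<R _ | unmoved A≤q _ = ⊥-elim (ℕₚ.<⇒≱ (ℕₚ.<-trans q<R R<A) A≤q)
... | moved q<R sR | moved q<A sA
  rewrite sR | sA | dec-false (R ℕ.≤? q ×-dec q ℕ.<? A) (λ p → ℕₚ.<⇒≱ q<R (proj₁ p)) = solve (+ A) (+ R)
  where solve : ∀ a b → (+ 2 ℤ.+ a) ℤ.- (+ 2 ℤ.+ b) ≡ (a ℤ.- b) ℤ.+ 0ℤ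
        solve = solve-∀

module _ {A : Set} where

  insertPair : ℕ → A → A → List A → List A
  insertPair q u d w = take q w ++ (u ∷ d ∷ drop q w)

  at-insertPair-before : ∀ q (u d : A) w x → q ≤ length w → x ≤ q → at (insertPair q u d w) x ≡ at w x
  at-insertPair-before zero u d [] zero _ _ = refl
  at-insertPair-before zero u d (a ∷ w) zero _ _ = refl
  at-insertPair-before (suc q) u d (a ∷ w) zero _ _ = refl
  at-insertPair-before (suc q) u d (a ∷ w) (suc zero) _ _ = refl
  at-insertPair-before (suc q) u d (a ∷ w) (suc (suc x)) q≤ x≤q =
    at-insertPair-before q u d w (suc x) (ℕₚ.≤-pred q≤) (ℕₚ.≤-pred x≤q)

  at-insertPair-first : ∀ q (u d : A) w → q ≤ length w → at (insertPair q u d w) (suc q) ≡ just u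
  at-insertPair-first zero u d w _ = refl
  at-insertPair-first (suc q) u d (a ∷ w) q≤ = at-insertPair-first q u d w (ℕₚ.≤-pred q≤)

  at-insertPair-second : ∀ q (u d : A) w → q ≤ length w → at (insertPair q u d w) (suc (suc q)) ≡ just d
  at-insertPair-second zero u d w _ = refl
  at-insertPair-second (suc q) u d (a ∷ w) q≤ = at-insertPair-second q u d w (ℕₚ.≤-pred q≤)

  at-insertPair-after : ∀ q (u d : A) w j → q ≤ length w → q < j → at (insertPair q u d w) (suc (suc j)) ≡ at w j
  at-insertPair-after zero u d w (suc j) _ _ = refl
  at-insertPair-after (suc q) u d (a ∷ w) (suc zero) _ (s≤s ())
  at-insertPair-after (suc q) u d (a ∷ w) (suc (suc j)) q≤ q<j =
    at-insertPair-after q u d w (suc j) (ℕₚ.≤-pred q≤) (ℕₚ.≤-pred q<j)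

  length-insertPair : ∀ q (u d : A) w → q ≤ length w → length (insertPair q u d w) ≡ suc (suc (length w))
  length-insertPair zero u d w _ = refl
  length-insertPair (suc q) u d (a ∷ w) q≤ = cong suc (length-insertPair q u d w (ℕₚ.≤-pred q≤))

  drop-insertPair-after : ∀ q (u d : A) w x → q ≤ length w → q < x → drop (suc (suc x)) (insertPair q u d w) ≡ drop x w
  drop-insertPair-after zero u d w x _ _ = refl
  drop-insertPair-after (suc q) u d (a ∷ w) (suc x) q≤ q<x = drop-insertPair-after q u d w x (ℕₚ.≤-pred q≤) (ℕₚ.≤-pred q<x)

  drop-insertPair-before : ∀ q (u d : A) w x → q ≤ length w → x ≤ q →
    Σ[ xs ∈ List A ] (drop x (insertPair q u d w) ≡ xs ++ u ∷ d ∷ drop q w) × (xs ++ drop q w ≡ drop x w) × (x + length xs ≡ q)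
  drop-insertPair-before q u d w zero q≤ _ =
    take q w , refl , Listₚ.take++drop≡id q w , trans (Listₚ.length-take q w) (ℕₚ.m≤n⇒m⊓n≡m q≤)
  drop-insertPair-before (suc q) u d (a ∷ w) (suc x) q≤ x≤q
    with drop-insertPair-before q u d w x (ℕₚ.≤-pred q≤) (ℕₚ.≤-pred x≤q)
  ... | xs , drop≡ , xs++ , x+xs = xs , drop≡ , xs++ , cong suc x+xs

  drop-insertPair-first : ∀ q (u d : A) w → q ≤ length w → drop (suc q) (insertPair q u d w) ≡ d ∷ drop q w
  drop-insertPair-first zero u d w _ = refl
  drop-insertPair-first (suc q) u d (a ∷ w) q≤ = drop-insertPair-first q u d w (ℕₚ.≤-pred q≤)

map-insertUD : ∀ i q (w : List (Step × ℕ)) → map proj₁ (insertUD i q w) ≡ insertPair q U D (map proj₁ w)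
map-insertUD i q w = trans (Listₚ.map-++ proj₁ (take q w) ((U , i) ∷ (D , i) ∷ drop q w))
  (cong₂ (λ xs ys → xs ++ U ∷ D ∷ ys) (sym (Listₚ.take-map q w)) (sym (Listₚ.drop-map q w)))

-- matchFrom returns the junk value 0 when there is no match; bump leaves it in place.
bump : ℕ → ℕ
bump zero = zero
bump (suc n) = suc (suc (suc n))

matchFrom-suc-suc : ∀ d pos ys → matchFrom d (suc (suc pos)) ys ≡ bump (matchFrom d pos ys)
matchFrom-suc-suc d pos [] = refl
matchFrom-suc-suc d pos (U ∷ ys) = matchFrom-suc-suc (suc d) (suc pos) ys
matchFrom-suc-suc zero pos (D ∷ ys) = refl
matchFrom-suc-suc (suc d) pos (D ∷ ys) = matchFrom-suc-suc d (suc pos) ys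

matchFrom-range : ∀ d pos ys → matchFrom d pos ys ≡ 0 ⊎ pos < matchFrom d pos ys
matchFrom-range d pos [] = inj₁ refl
matchFrom-range d pos (U ∷ ys) with matchFrom-range (suc d) (suc pos) ys
... | inj₁ ≡0 = inj₁ ≡0
... | inj₂ lt = inj₂ (ℕₚ.<-trans (ℕₚ.n<1+n pos) lt)
matchFrom-range zero pos (D ∷ ys) = inj₂ (ℕₚ.n<1+n pos)
matchFrom-range (suc d) pos (D ∷ ys) with matchFrom-range d (suc pos) ys
... | inj₁ ≡0 = inj₁ ≡0
... | inj₂ lt = inj₂ (ℕₚ.<-trans (ℕₚ.n<1+n pos) lt)

shift≡bump : ∀ b z → z ≡ 0 ⊎ b < z → shift b z ≡ bump z
shift≡bump b zero _ = shift-≤ {b} {0} z≤n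
shift≡bump b (suc z) (inj₂ b<z) = shift-> b<z

matchFrom-insert : ∀ d pos xs ys →
  matchFrom d pos (xs ++ U ∷ D ∷ ys) ≡ shift (pos + length xs) (matchFrom d pos (xs ++ ys))
matchFrom-insert d pos [] ys = trans (matchFrom-suc-suc d pos ys)
  (sym (trans (cong (λ b → shift b (matchFrom d pos ys)) (ℕₚ.+-identityʳ pos)) (shift≡bump pos _ (matchFrom-range d pos ys))))
matchFrom-insert d pos (U ∷ xs) ys = trans (matchFrom-insert (suc d) (suc pos) xs ys)
  (cong (λ b → shift b (matchFrom (suc d) (suc pos) (xs ++ ys))) (sym (ℕₚ.+-suc pos (length xs))))
matchFrom-insert zero pos (D ∷ xs) ys = sym (shift-≤ {pos + suc (length xs)} {suc pos}
  (ℕₚ.≤-trans (s≤s (ℕₚ.m≤m+n pos (length xs))) (ℕₚ.≤-reflexive (sym (ℕₚ.+-suc pos (length xs))))))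
matchFrom-insert (suc d) pos (D ∷ xs) ys = trans (matchFrom-insert d (suc pos) xs ys)
  (cong (λ b → shift b (matchFrom d (suc pos) (xs ++ ys))) (sym (ℕₚ.+-suc pos (length xs))))

mate-insert : ∀ q v x → q ≤ length v → mate (insertPair q U D v) (shift q x) ≡ shift q (mate v x)
mate-insert q v x q≤ with shiftCase q x
... | unmoved x≤q sx rewrite sx with drop-insertPair-before q U D v x q≤ x≤q
...   | xs , drop≡ , xs++ , x+xs rewrite drop≡ | matchFrom-insert 0 x xs (drop q v) | xs++ | x+xs = refl
mate-insert q v x q≤ | moved q<x sx rewrite sx | drop-insertPair-after q U D v x q≤ q<x =
  trans (matchFrom-suc-suc 0 x (drop x v)) (sym (shift≡bump q (mate v x) (range (matchFrom-range 0 x (drop x v)))))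
  where
  range : mate v x ≡ 0 ⊎ x < mate v x → mate v x ≡ 0 ⊎ q < mate v x
  range (inj₁ ≡0) = inj₁ ≡0
  range (inj₂ x<) = inj₂ (ℕₚ.<-trans q<x x<)

mate-insert-new : ∀ q v → q ≤ length v → mate (insertPair q U D v) (suc q) ≡ suc (suc q)
mate-insert-new q v q≤ rewrite drop-insertPair-first q U D v q≤ = refl

applyUpTo≡map-interval : ∀ (f : ℕ → ℕ) n → applyUpTo f n ≡ map f (interval 0 n)
applyUpTo≡map-interval f zero = refl
applyUpTo≡map-interval f (suc n) = cong (f 0 ∷_) (trans (applyUpTo≡map-interval (λ x → f (suc x)) n)
  (trans (Listₚ.map-∘ (interval 0 n)) (cong (map f) (sym (interval-suc 0 n)))))

map-suc-upTo : ∀ n → map suc (upTo n) ≡ interval 1 n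
map-suc-upTo n = trans (cong (map suc) (trans (applyUpTo≡map-interval (λ x → x) n) (Listₚ.map-id (interval 0 n))))
                       (sym (interval-suc 0 n))

interval-∷ʳ : ∀ b n → interval b (suc n) ≡ interval b n ++ (b + n) ∷ []
interval-∷ʳ b zero = cong (λ x → x ∷ []) (sym (ℕₚ.+-identityʳ b))
interval-∷ʳ b (suc n) =
  cong (b ∷_) (trans (interval-∷ʳ (suc b) n) (cong (λ x → interval (suc b) n ++ x ∷ []) (sym (ℕₚ.+-suc b n))))

all-interval : ∀ b n → All (λ i → b ≤ i × i < b + n) (interval b n)
all-interval b zero = []
all-interval b (suc n) = (ℕₚ.≤-refl , ℕₚ.≤-trans (s≤s (ℕₚ.m≤m+n b n)) (ℕₚ.≤-reflexive (sym (ℕₚ.+-suc b n))))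
  ∷ All.map (λ p → ℕₚ.≤-trans (ℕₚ.n≤1+n b) (proj₁ p) , ℕₚ.≤-trans (proj₂ p) (ℕₚ.≤-reflexive (sym (ℕₚ.+-suc b n))))
            (all-interval (suc b) n)

length-filter-++ : ∀ {A : Set} {P : A → Set} (P? : (a : A) → Dec (P a)) xs ys →
  length (filter P? (xs ++ ys)) ≡ length (filter P? xs) + length (filter P? ys)
length-filter-++ P? xs ys = trans (cong length (Listₚ.filter-++ P? xs ys)) (Listₚ.length-++ (filter P? xs))

length-filter-[_] : ∀ {A : Set} {P : A → Set} {P? : (a : A) → Dec (P a)} x → length (filter P? (x ∷ [])) ≡ indicator (P? x)
length-filter-[_] {P? = P?} x with does (P? x)
... | true = refl
... | false = refl

sumℤ-++ : ∀ xs ys → sumℤ (xs ++ ys) ≡ sumℤ xs ℤ.+ sumℤ ys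
sumℤ-++ [] ys = sym (ℤₚ.+-identityˡ (sumℤ ys))
sumℤ-++ (x ∷ xs) ys = trans (cong (λ s → x ℤ.+ s) (sumℤ-++ xs ys)) (sym (ℤₚ.+-assoc x (sumℤ xs) (sumℤ ys)))

sumℤ-+ : ∀ {A : Set} (f g : A → ℤ) xs → sumℤ (map (λ i → f i ℤ.+ g i) xs) ≡ sumℤ (map f xs) ℤ.+ sumℤ (map g xs)
sumℤ-+ f g [] = refl
sumℤ-+ f g (x ∷ xs) =
  trans (cong (λ s → f x ℤ.+ g x ℤ.+ s) (sumℤ-+ f g xs)) (solve (f x) (g x) (sumℤ (map f xs)) (sumℤ (map g xs)))
  where solve : ∀ a b c d → (a ℤ.+ b) ℤ.+ (c ℤ.+ d) ≡ (a ℤ.+ c) ℤ.+ (b ℤ.+ d)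
        solve = solve-∀

sumℤ-2*indicator : ∀ {A : Set} {P : A → Set} (P? : (a : A) → Dec (P a)) xs →
  sumℤ (map (λ i → + (2 * indicator (P? i))) xs) ≡ + (2 * length (filter P? xs))
sumℤ-2*indicator P? [] = refl
sumℤ-2*indicator P? (x ∷ xs) with does (P? x)
... | true rewrite sumℤ-2*indicator P? xs = cong +_ (sym (ℕₚ.*-suc 2 (length (filter P? xs))))
... | false rewrite sumℤ-2*indicator P? xs = refl

+2+-⊖ : ∀ a b → b ≤ a → + (2 + a) ℤ.- + (2 + b) ≡ + (a ∸ b)
+2+-⊖ a b b≤a = trans (ℤₚ.m-n≡m⊖n (2 + a) (2 + b)) (ℤₚ.⊖-≥ (s≤s (s≤s b≤a)))

-- Positions of the chords labelled i after chord suc k has been inserted with up step suc q;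
-- v is the new chord's own position.
extend : ℕ → ℕ → ℕ → (ℕ → ℕ) → ℕ → ℕ
extend k q v f i = if ⌊ i ℕ.≟ suc k ⌋ then v else shift q (f i)

extend-old : ∀ k q v f {i} → i ≢ suc k → extend k q v f i ≡ shift q (f i)
extend-old k q v f {i} i≢ rewrite isYes-false (i ℕ.≟ suc k) i≢ = refl

extend-new : ∀ k q v f → extend k q v f (suc k) ≡ v
extend-new k q v f rewrite ≟-refl (suc k) = refl

-- Each descent i contributes a box to every column in [r (suc i), ℓ i).
coveringDescents : ℕ → (ℕ → ℕ) → (ℕ → ℕ) → ℕ → ℕ
coveringDescents k ℓ r j = length (filter (λ i → r (suc i) ℕ.≤? j ×-dec j ℕ.<? ℓ i) (DES k ℓ))

DescentsSeparated : ℕ → (ℕ → ℕ) → (ℕ → ℕ) → Set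
DescentsSeparated k ℓ r = ∀ i → 1 ≤ i → i < k → ℓ (suc i) < ℓ i → r (suc i) < ℓ i

module RHSStep (k₀ q : ℕ) (ℓ r : ℕ → ℕ) (separated : DescentsSeparated (suc k₀) ℓ r) where

  k = suc k₀
  ℓ′ = extend k q (suc q) ℓ
  r′ = extend k q (suc (suc q)) r

  private
    i<k⇒i≢ : ∀ {i} → i < k → i ≢ suc k
    i<k⇒i≢ i<k = ℕₚ.<⇒≢ (ℕₚ.<-trans i<k (ℕₚ.n<1+n k))

    i<k⇒suc-i≢ : ∀ {i} → i < k → suc i ≢ suc k
    i<k⇒suc-i≢ i<k eq = ℕₚ.<⇒≢ i<k (ℕₚ.suc-injective eq)

    k≢ : k ≢ suc k
    k≢ = ℕₚ.<⇒≢ (ℕₚ.n<1+n k)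

  descent? : (f : ℕ → ℕ) → (i : ℕ) → Dec (f (suc i) < f i)
  descent? f i = f (suc i) ℕ.<? f i

  newDescent = filter (descent? ℓ′) (k ∷ [])

  DescentIndex : ℕ → Set
  DescentIndex i = (1 ≤ i × i < k) × ℓ (suc i) < ℓ i

  all-DES : All DescentIndex (DES k ℓ)
  all-DES rewrite map-suc-upTo k₀ =
    All.zip (Allₚ.filter⁺ (descent? ℓ) (all-interval 1 k₀) , Allₚ.all-filter (descent? ℓ) (interval 1 k₀))

  DES-step : DES (suc k) ℓ′ ≡ DES k ℓ ++ newDescent
  DES-step = begin
      filter (descent? ℓ′) (map suc (upTo k))
    ≡⟨ cong (filter (descent? ℓ′)) (trans (map-suc-upTo k) (interval-∷ʳ 1 k₀)) ⟩
      filter (descent? ℓ′) (interval 1 k₀ ++ k ∷ [])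
    ≡⟨ Listₚ.filter-++ (descent? ℓ′) (interval 1 k₀) (k ∷ []) ⟩
      filter (descent? ℓ′) (interval 1 k₀) ++ newDescent
    ≡⟨ cong (_++ newDescent) (trans (filter-cong-local (descent? ℓ′) (descent? ℓ) (All.map unchanged (all-interval 1 k₀)))
                                  (cong (filter (descent? ℓ)) (sym (map-suc-upTo k₀)))) ⟩
      DES k ℓ ++ newDescent ∎
    where
    open ≡-Reasoning
    unchanged : ∀ {i} → 1 ≤ i × i < 1 + k₀ → does (descent? ℓ′ i) ≡ does (descent? ℓ i)
    unchanged {i} (_ , i<k) =
      trans (cong₂ (λ a b → does (a ℕ.<? b)) (extend-old k q _ ℓ (i<k⇒suc-i≢ i<k)) (extend-old k q _ ℓ (i<k⇒i≢ i<k)))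
            (does-⇔ (shift-<-⇔ q (ℓ (suc i)) (ℓ i)) (shift q (ℓ (suc i)) ℕ.<? shift q (ℓ i)) (ℓ (suc i) ℕ.<? ℓ i))

  ℓ′k : ℓ′ k ≡ shift q (ℓ k)
  ℓ′k = extend-old k q _ ℓ k≢

  newDescent-does : does (descent? ℓ′ k) ≡ does (suc q ℕ.<? shift q (ℓ k))
  newDescent-does = cong₂ (λ a b → does (a ℕ.<? b)) (extend-new k q _ ℓ) ℓ′k

  newDescent-yes : q < ℓ k → newDescent ≡ k ∷ []
  newDescent-yes q<ℓk = Listₚ.filter-accept (descent? ℓ′) {k} {[]} (does-sound (descent? ℓ′ k)
    (trans newDescent-does (dec-true (suc q ℕ.<? shift q (ℓ k)) (Equivalence.from (suc-<-shift-⇔ q (ℓ k)) q<ℓk))))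

  newDescent-no : ℓ k ≤ q → newDescent ≡ []
  newDescent-no ℓk≤q = Listₚ.filter-reject (descent? ℓ′) {k} {[]} not-descent
    where
    not-descent : ¬ (ℓ′ (suc k) < ℓ′ k)
    not-descent d = ℕₚ.<⇒≱ (Equivalence.to (suc-<-shift-⇔ q (ℓ k)) (subst₂ _<_ (extend-new k q _ ℓ) ℓ′k d)) ℓk≤q

  coveringDescents-step : ∀ j →
    coveringDescents (suc k) ℓ′ r′ j
    ≡ coveringDescents k ℓ r (unspread q j) + indicator (suc q ℕ.<? j ×-dec j ℕ.<? suc (suc (ℓ k)))
  coveringDescents-step j = begin
      length (filter covers′ (DES (suc k) ℓ′))
    ≡⟨ cong (λ ds → length (filter covers′ ds)) DES-step ⟩
      length (filter covers′ (DES k ℓ ++ newDescent))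
    ≡⟨ length-filter-++ covers′ (DES k ℓ) newDescent ⟩
      length (filter covers′ (DES k ℓ)) + length (filter covers′ newDescent)
    ≡⟨ cong₂ _+_ (cong length (filter-cong-local covers′ covers (All.map unchanged all-DES))) new ⟩
      coveringDescents k ℓ r (unspread q j) + indicator (suc q ℕ.<? j ×-dec j ℕ.<? suc (suc (ℓ k))) ∎
    where
    open ≡-Reasoning
    covers′ : (i : ℕ) → Dec (r′ (suc i) ≤ j × j < ℓ′ i)
    covers′ i = r′ (suc i) ℕ.≤? j ×-dec j ℕ.<? ℓ′ i
    covers : (i : ℕ) → Dec (r (suc i) ≤ unspread q j × unspread q j < ℓ i)
    covers i = r (suc i) ℕ.≤? unspread q j ×-dec unspread q j ℕ.<? ℓ i
    unchanged : ∀ {i} → DescentIndex i → does (covers′ i) ≡ does (covers i)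
    unchanged {i} ((_ , i<k) , _) =
      trans (cong₂ (λ a b → does (a ℕ.≤? j ×-dec j ℕ.<? b)) (extend-old k q _ r (i<k⇒suc-i≢ i<k)) (extend-old k q _ ℓ (i<k⇒i≢ i<k)))
            (does-⇔ (shift-≤-⇔ q (r (suc i)) j ×-⇔ <-shift-⇔ q (ℓ i) j)
                    (shift q (r (suc i)) ℕ.≤? j ×-dec j ℕ.<? shift q (ℓ i)) (covers i))
    new : length (filter covers′ newDescent) ≡ indicator (suc q ℕ.<? j ×-dec j ℕ.<? suc (suc (ℓ k)))
    new with q ℕ.<? ℓ k
    ... | yes q<ℓk rewrite newDescent-yes q<ℓk = trans (length-filter-[_] {P? = covers′} k)
          (cong (λ b → if b then 1 else 0)
            (cong₂ (λ a b → does (a ℕ.≤? j ×-dec j ℕ.<? b)) (extend-new k q _ r) (trans ℓ′k (shift-> q<ℓk))))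
    ... | no q≮ℓk rewrite newDescent-no (ℕₚ.≮⇒≥ q≮ℓk) =
          sym (cong (λ b → if b then 1 else 0) (dec-false (suc q ℕ.<? j ×-dec j ℕ.<? suc (suc (ℓ k)))
            (λ p → ℕₚ.<⇒≱ (proj₂ p) (ℕₚ.≤-trans (s≤s (s≤s (ℕₚ.≮⇒≥ q≮ℓk))) (proj₁ p)))))

  descentTerm : (ℕ → ℕ) → (ℕ → ℕ) → ℕ → ℤ
  descentTerm L R i = + L i ℤ.- + R (suc i)

  newDescent-sum : ∀ (f : ℕ → ℤ) → f k ≡ descentTerm ℓ′ r′ k → sumℤ (map f newDescent) ≡ + (ℓ k ∸ q)
  newDescent-sum f fk with q ℕ.<? ℓ k
  ... | yes q<ℓk rewrite newDescent-yes q<ℓk = trans (ℤₚ.+-identityʳ (f k)) (trans fk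
        (trans (cong₂ (λ a b → + a ℤ.- + b) (trans ℓ′k (shift-> q<ℓk)) (extend-new k q _ r)) (+2+-⊖ (ℓ k) q (ℕₚ.<⇒≤ q<ℓk))))
  ... | no q≮ℓk rewrite newDescent-no (ℕₚ.≮⇒≥ q≮ℓk) | ℕₚ.m≤n⇒m∸n≡0 (ℕₚ.≮⇒≥ q≮ℓk) = refl

  descentTerm-step : ∀ {i} → DescentIndex i →
    descentTerm ℓ′ r′ i ≡ descentTerm ℓ r i ℤ.+ + (2 * indicator (r (suc i) ℕ.≤? q ×-dec q ℕ.<? ℓ i))
  descentTerm-step {i} ((1≤i , i<k) , descent) =
    trans (cong₂ (λ a b → + a ℤ.- + b) (extend-old k q _ ℓ (i<k⇒i≢ i<k)) (extend-old k q _ r (i<k⇒suc-i≢ i<k)))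
          (shift-difference q (r (suc i)) (ℓ i) (separated i 1≤i i<k descent))

  areaRHS-step : areaRHS (suc k) ℓ′ r′ ≡ areaRHS k ℓ r ℤ.+ + (2 * coveringDescents k ℓ r q + (ℓ k ∸ q))
  areaRHS-step = begin
      sumℤ (map (descentTerm ℓ′ r′) (DES (suc k) ℓ′))
    ≡⟨ cong (λ ds → sumℤ (map (descentTerm ℓ′ r′) ds)) DES-step ⟩
      sumℤ (map (descentTerm ℓ′ r′) (DES k ℓ ++ newDescent))
    ≡⟨ cong sumℤ (Listₚ.map-++ (descentTerm ℓ′ r′) (DES k ℓ) newDescent) ⟩
      sumℤ (map (descentTerm ℓ′ r′) (DES k ℓ) ++ map (descentTerm ℓ′ r′) newDescent)
    ≡⟨ sumℤ-++ (map (descentTerm ℓ′ r′) (DES k ℓ)) (map (descentTerm ℓ′ r′) newDescent) ⟩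
      sumℤ (map (descentTerm ℓ′ r′) (DES k ℓ)) ℤ.+ sumℤ (map (descentTerm ℓ′ r′) newDescent)
    ≡⟨ cong₂ ℤ._+_ (cong sumℤ (Listₚ.map-cong-local (All.map descentTerm-step all-DES))) (newDescent-sum (descentTerm ℓ′ r′) refl) ⟩
      sumℤ (map (λ i → descentTerm ℓ r i ℤ.+ + (2 * indicator (covers-q i))) (DES k ℓ)) ℤ.+ + (ℓ k ∸ q)
    ≡⟨ cong (ℤ._+ + (ℓ k ∸ q)) (trans (sumℤ-+ (descentTerm ℓ r) (λ i → + (2 * indicator (covers-q i))) (DES k ℓ))
                                       (cong (λ s → areaRHS k ℓ r ℤ.+ s) (sumℤ-2*indicator covers-q (DES k ℓ)))) ⟩
      (areaRHS k ℓ r ℤ.+ + (2 * coveringDescents k ℓ r q)) ℤ.+ + (ℓ k ∸ q)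
    ≡⟨ ℤₚ.+-assoc (areaRHS k ℓ r) (+ (2 * coveringDescents k ℓ r q)) (+ (ℓ k ∸ q)) ⟩
      areaRHS k ℓ r ℤ.+ + (2 * coveringDescents k ℓ r q + (ℓ k ∸ q)) ∎
    where
    open ≡-Reasoning
    covers-q : (i : ℕ) → Dec (r (suc i) ≤ q × q < ℓ i)
    covers-q i = r (suc i) ℕ.≤? q ×-dec q ℕ.<? ℓ i

  separated-step : DescentsSeparated (suc k) ℓ′ r′
  separated-step i 1≤i i<k+1 descent with ℕₚ.<-cmp i k
  ... | tri< i<k _ _ =
    subst₂ _<_ (sym (extend-old k q _ r (i<k⇒suc-i≢ i<k))) (sym (extend-old k q _ ℓ (i<k⇒i≢ i<k)))
      (Equivalence.from (shift-<-⇔ q (r (suc i)) (ℓ i))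
        (separated i 1≤i i<k (Equivalence.to (shift-<-⇔ q (ℓ (suc i)) (ℓ i))
          (subst₂ _<_ (extend-old k q _ ℓ (i<k⇒suc-i≢ i<k)) (extend-old k q _ ℓ (i<k⇒i≢ i<k)) descent))))
  ... | tri≈ _ refl _ rewrite extend-new k q (suc q) ℓ | extend-new k q (suc (suc q)) r | ℓ′k =
    new-gap (Equivalence.to (suc-<-shift-⇔ q (ℓ k)) descent)
    where
    new-gap : q < ℓ k → suc (suc q) < shift q (ℓ k)
    new-gap q<ℓk rewrite shift-> q<ℓk = s≤s (s≤s q<ℓk)
  ... | tri> _ _ k<i = ⊥-elim (ℕₚ.<⇒≱ i<k+1 k<i)

  -- The new chord suc k crosses into the gap of descent i exactly when r (suc i) ≤ q < ℓ i.
  crossCount-step : ∀ i → i < k →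
    crossCount (suc k) ℓ′ r′ i ≡ crossCount k ℓ r i + indicator (r (suc i) ℕ.≤? q ×-dec q ℕ.<? ℓ i)
  crossCount-step i i<k = begin
      length (filter crosses′ (map index (upTo (suc k ∸ suc i))))
    ≡⟨ cong (λ n → length (filter crosses′ (map index (upTo n)))) (ℕₚ.+-∸-assoc 1 i≤k₀) ⟩
      length (filter crosses′ (map index (upTo (suc d))))
    ≡⟨ cong (λ ns → length (filter crosses′ (map index ns))) (sym (Listₚ.upTo-∷ʳ d)) ⟩
      length (filter crosses′ (map index (upTo d ++ d ∷ [])))
    ≡⟨ cong (λ ns → length (filter crosses′ ns)) (Listₚ.map-++ index (upTo d) (d ∷ [])) ⟩
      length (filter crosses′ (map index (upTo d) ++ index d ∷ []))
    ≡⟨ length-filter-++ crosses′ (map index (upTo d)) (index d ∷ []) ⟩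
      length (filter crosses′ (map index (upTo d))) + length (filter crosses′ (index d ∷ []))
    ≡⟨ cong₂ _+_ (cong length (filter-cong-local crosses′ crosses (Allₚ.map⁺ (All.map unchanged (Allₚ.all-upTo d))))) new ⟩
      crossCount k ℓ r i + indicator (r (suc i) ℕ.≤? q ×-dec q ℕ.<? ℓ i) ∎
    where
    open ≡-Reasoning
    i≤k₀ : i ≤ k₀
    i≤k₀ = ℕₚ.≤-pred i<k
    d = k₀ ∸ i
    index : ℕ → ℕ
    index t = t + (2 + i)
    crosses′ : (j : ℕ) → Dec (r′ (suc i) < ℓ′ j × ℓ′ j < ℓ′ i)
    crosses′ j = r′ (suc i) ℕ.<? ℓ′ j ×-dec ℓ′ j ℕ.<? ℓ′ i
    crosses : (j : ℕ) → Dec (r (suc i) < ℓ j × ℓ j < ℓ i)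
    crosses j = r (suc i) ℕ.<? ℓ j ×-dec ℓ j ℕ.<? ℓ i
    index-d : index d ≡ suc k
    index-d = trans (ℕₚ.+-suc d (suc i)) (cong suc (trans (ℕₚ.+-suc d i) (cong suc (ℕₚ.m∸n+n≡m i≤k₀))))
    unchanged : ∀ {t} → t < d → does (crosses′ (index t)) ≡ does (crosses (index t))
    unchanged {t} t<d = trans
      (cong₃ (λ a b c → does (a ℕ.<? b ×-dec b ℕ.<? c))
        (extend-old k q _ r (i<k⇒suc-i≢ i<k)) (extend-old k q _ ℓ index-t≢) (extend-old k q _ ℓ (i<k⇒i≢ i<k)))
      (does-⇔ (shift-<-⇔ q (r (suc i)) (ℓ (index t)) ×-⇔ shift-<-⇔ q (ℓ (index t)) (ℓ i))
        (shift q (r (suc i)) ℕ.<? shift q (ℓ (index t)) ×-dec shift q (ℓ (index t)) ℕ.<? shift q (ℓ i)) (crosses (index t)))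
      where
      index-t≢ : index t ≢ suc k
      index-t≢ = ℕₚ.<⇒≢ (subst (index t <_) index-d (ℕₚ.+-monoˡ-< (2 + i) t<d))
    new : length (filter crosses′ (index d ∷ [])) ≡ indicator (r (suc i) ℕ.≤? q ×-dec q ℕ.<? ℓ i)
    new rewrite index-d = trans (length-filter-[_] {P? = crosses′} (suc k))
      (cong (λ b → if b then 1 else 0) (trans
        (cong₃ (λ a b c → does (a ℕ.<? b ×-dec b ℕ.<? c))
          (extend-old k q _ r (i<k⇒suc-i≢ i<k)) (extend-new k q _ ℓ) (extend-old k q _ ℓ (i<k⇒i≢ i<k)))
        (does-⇔ (shift-<-suc-⇔ q (r (suc i)) ×-⇔ suc-<-shift-⇔ q (ℓ i))
          (shift q (r (suc i)) ℕ.<? suc q ×-dec suc q ℕ.<? shift q (ℓ i)) (r (suc i) ℕ.≤? q ×-dec q ℕ.<? ℓ i))))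

  tilesTerm : (ℕ → ℕ) → (ℕ → ℕ) → ℕ → ℕ → ℤ
  tilesTerm L R n i = + L i ℤ.- + R (suc i) ℤ.- + (2 * crossCount n L R i)

  -- The area term of an old descent and twice its crossing count grow by the same amount.
  tilesTerm-step : ∀ {i} → DescentIndex i → tilesTerm ℓ′ r′ (suc k) i ≡ tilesTerm ℓ r k i
  tilesTerm-step {i} d@((_ , i<k) , _) = begin
      descentTerm ℓ′ r′ i ℤ.- + (2 * crossCount (suc k) ℓ′ r′ i)
    ≡⟨ cong₂ (λ a c → a ℤ.- + (2 * c)) (descentTerm-step d) (crossCount-step i i<k) ⟩
      (descentTerm ℓ r i ℤ.+ + (2 * b)) ℤ.- + (2 * (crossCount k ℓ r i + b))
    ≡⟨ cong (λ x → (descentTerm ℓ r i ℤ.+ + (2 * b)) ℤ.- + x) (ℕₚ.*-distribˡ-+ 2 (crossCount k ℓ r i) b) ⟩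
      (descentTerm ℓ r i ℤ.+ + (2 * b)) ℤ.- (+ (2 * crossCount k ℓ r i) ℤ.+ + (2 * b))
    ≡⟨ solve (descentTerm ℓ r i) (+ (2 * crossCount k ℓ r i)) (+ (2 * b)) ⟩
      tilesTerm ℓ r k i ∎
    where
    open ≡-Reasoning
    b = indicator (r (suc i) ℕ.≤? q ×-dec q ℕ.<? ℓ i)
    solve : ∀ x c b → (x ℤ.+ b) ℤ.- (c ℤ.+ b) ≡ x ℤ.- c
    solve = solve-∀

  tilesRHS-step : tilesRHS (suc k) ℓ′ r′ ≡ tilesRHS k ℓ r ℤ.+ + (ℓ k ∸ q)
  tilesRHS-step = begin
      sumℤ (map (tilesTerm ℓ′ r′ (suc k)) (DES (suc k) ℓ′))
    ≡⟨ cong (λ ds → sumℤ (map (tilesTerm ℓ′ r′ (suc k)) ds)) DES-step ⟩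
      sumℤ (map (tilesTerm ℓ′ r′ (suc k)) (DES k ℓ ++ newDescent))
    ≡⟨ cong sumℤ (Listₚ.map-++ (tilesTerm ℓ′ r′ (suc k)) (DES k ℓ) newDescent) ⟩
      sumℤ (map (tilesTerm ℓ′ r′ (suc k)) (DES k ℓ) ++ map (tilesTerm ℓ′ r′ (suc k)) newDescent)
    ≡⟨ sumℤ-++ (map (tilesTerm ℓ′ r′ (suc k)) (DES k ℓ)) (map (tilesTerm ℓ′ r′ (suc k)) newDescent) ⟩
      sumℤ (map (tilesTerm ℓ′ r′ (suc k)) (DES k ℓ)) ℤ.+ sumℤ (map (tilesTerm ℓ′ r′ (suc k)) newDescent)
    ≡⟨ cong₂ ℤ._+_ (cong sumℤ (Listₚ.map-cong-local (All.map tilesTerm-step all-DES)))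
                   (newDescent-sum (tilesTerm ℓ′ r′ (suc k)) no-crossings) ⟩
      tilesRHS k ℓ r ℤ.+ + (ℓ k ∸ q) ∎
    where
    open ≡-Reasoning
    no-crossings : tilesTerm ℓ′ r′ (suc k) k ≡ descentTerm ℓ′ r′ k
    no-crossings rewrite ℕₚ.n∸n≡0 k₀ = ℤₚ.+-identityʳ (descentTerm ℓ′ r′ k)

separated-step : ∀ k q ℓ r → DescentsSeparated k ℓ r → DescentsSeparated (suc k) (extend k q (suc q) ℓ) (extend k q (suc (suc q)) r)
separated-step zero q ℓ r _ i 1≤i i<1 = ⊥-elim (ℕₚ.<⇒≱ i<1 1≤i)
separated-step (suc k₀) q ℓ r separated = RHSStep.separated-step k₀ q ℓ r separated

coveringDescents-step : ∀ k q ℓ r → DescentsSeparated k ℓ r → ℓ 0 ≡ 0 → ∀ j →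
  coveringDescents (suc k) (extend k q (suc q) ℓ) (extend k q (suc (suc q)) r) j
  ≡ coveringDescents k ℓ r (unspread q j) + indicator (suc q ℕ.<? j ×-dec j ℕ.<? suc (suc (ℓ k)))
coveringDescents-step zero q ℓ r _ ℓ0≡0 j rewrite ℓ0≡0 = sym (cong (λ b → if b then 1 else 0)
  (dec-false (suc q ℕ.<? j ×-dec j ℕ.<? 2) (λ p → ℕₚ.<⇒≱ (proj₂ p) (ℕₚ.≤-trans (s≤s (s≤s z≤n)) (proj₁ p)))))
coveringDescents-step (suc k₀) q ℓ r separated _ = RHSStep.coveringDescents-step k₀ q ℓ r separated

areaRHS-step : ∀ k q ℓ r → DescentsSeparated k ℓ r → ℓ 0 ≡ 0 →
  areaRHS (suc k) (extend k q (suc q) ℓ) (extend k q (suc (suc q)) r)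
  ≡ areaRHS k ℓ r ℤ.+ + (2 * coveringDescents k ℓ r q + (ℓ k ∸ q))
areaRHS-step zero q ℓ r _ ℓ0≡0 rewrite ℓ0≡0 | ℕₚ.0∸n≡0 q = refl
areaRHS-step (suc k₀) q ℓ r separated _ = RHSStep.areaRHS-step k₀ q ℓ r separated

tilesRHS-step : ∀ k q ℓ r → DescentsSeparated k ℓ r → ℓ 0 ≡ 0 →
  tilesRHS (suc k) (extend k q (suc q) ℓ) (extend k q (suc (suc q)) r) ≡ tilesRHS k ℓ r ℤ.+ + (ℓ k ∸ q)
tilesRHS-step zero q ℓ r _ ℓ0≡0 rewrite ℓ0≡0 | ℕₚ.0∸n≡0 q = refl
tilesRHS-step (suc k₀) q ℓ r separated _ = RHSStep.tilesRHS-step k₀ q ℓ r separated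

-- After k growth steps: w is the labelled word, T the tiling in natural coordinates, and ℓ i, r i
-- are the positions of the up and down steps of the chord labelled i (ℓ 0 = 0 is a dummy).
record GrowthInvariant (k : ℕ) (w : List (Step × ℕ)) (T : NTiling) (ℓ r : ℕ → ℕ) : Set where
  field
    length≡    : length w ≡ 2 * k
    up-steps   : ∀ x i → at w x ≡ just (U , i) → i ≤ k × x ≡ ℓ i
    down-steps : ∀ i → i ≤ k → mate (map proj₁ w) (ℓ i) ≡ r i
    separated  : DescentsSeparated k ℓ r
    ℓ0≡0       : ℓ 0 ≡ 0
    shape      : GrowthShape k (ℓ k) T
    boxes≡     : ∀ j → j ≤ 2 * k → boxesAtN T j ≡ coveringDescents k ℓ r j
    area≡      : + areaN T ≡ areaRHS k ℓ r
    tiles≡     : + tilesN T ≡ tilesRHS k ℓ r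
open GrowthInvariant

unspread-≤ : ∀ k q j → q ≤ 2 * k → j ≤ 2 * suc k → unspread q j ≤ 2 * k
unspread-≤ k q j q≤ j≤ with spreadColumn q j
... | before j≤q rewrite unspread-before j≤q = ℕₚ.≤-trans j≤q q≤
... | middle rewrite unspread-middle q = q≤
... | copy rewrite unspread-copy q = q≤
... | after q<j rewrite unspread-after q<j | 2*suc k = ℕₚ.≤-pred (ℕₚ.≤-pred j≤)

module InvariantStep (k : ℕ) (w : List (Step × ℕ)) (T : NTiling) (ℓ r : ℕ → ℕ) (I : GrowthInvariant k w T ℓ r)
                     (q : ℕ) (q≤2k : q ≤ 2 * k) where

  ℓ′ = extend k q (suc q) ℓ
  r′ = extend k q (suc (suc q)) r
  w′ = insertUD (suc k) q w

  q≤∣w∣ : q ≤ length w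
  q≤∣w∣ = ℕₚ.≤-trans q≤2k (ℕₚ.≤-reflexive (sym (length≡ I)))

  q≤∣map-w∣ : q ≤ length (map proj₁ w)
  q≤∣map-w∣ = ℕₚ.≤-trans q≤∣w∣ (ℕₚ.≤-reflexive (sym (Listₚ.length-map proj₁ w)))

  i≤k⇒i≢ : ∀ {i} → i ≤ k → i ≢ suc k
  i≤k⇒i≢ i≤k = ℕₚ.<⇒≢ (s≤s i≤k)

  length≡′ : length w′ ≡ 2 * suc k
  length≡′ = trans (length-insertPair q (U , suc k) (D , suc k) w q≤∣w∣)
                   (trans (cong (λ n → suc (suc n)) (length≡ I)) (sym (2*suc k)))

  up-steps′ : ∀ x i → at w′ x ≡ just (U , i) → i ≤ suc k × x ≡ ℓ′ i
  up-steps′ x i at≡ with spreadColumn q x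
  ... | before x≤q with up-steps I x i (trans (sym (at-insertPair-before q (U , suc k) (D , suc k) w x q≤∣w∣ x≤q)) at≡)
  ...   | i≤k , x≡ =
    ℕₚ.m≤n⇒m≤1+n i≤k , trans x≡ (sym (trans (extend-old k q _ ℓ (i≤k⇒i≢ i≤k)) (shift-≤ (subst (_≤ q) x≡ x≤q))))
  up-steps′ x i at≡ | middle with trans (sym (at-insertPair-first q (U , suc k) (D , suc k) w q≤∣w∣)) at≡
  ... | refl = ℕₚ.≤-refl , sym (extend-new k q _ ℓ)
  up-steps′ x i at≡ | copy with trans (sym (at-insertPair-second q (U , suc k) (D , suc k) w q≤∣w∣)) at≡
  ... | ()
  up-steps′ x i at≡ | after {j} q<j
    with up-steps I j i (trans (sym (at-insertPair-after q (U , suc k) (D , suc k) w j q≤∣w∣ q<j)) at≡)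
  ... | i≤k , j≡ = ℕₚ.m≤n⇒m≤1+n i≤k ,
    sym (trans (extend-old k q _ ℓ (i≤k⇒i≢ i≤k)) (trans (shift-> (subst (q <_) j≡ q<j)) (cong (λ z → suc (suc z)) (sym j≡))))

  down-steps′ : ∀ i → i ≤ suc k → mate (map proj₁ w′) (ℓ′ i) ≡ r′ i
  down-steps′ i i≤ with ℕₚ.<-cmp i (suc k)
  ... | tri< i<k+1 _ _ = begin
      mate (map proj₁ w′) (ℓ′ i)                        ≡⟨ cong₂ mate (map-insertUD (suc k) q w) (extend-old k q _ ℓ i≢) ⟩
      mate (insertPair q U D (map proj₁ w)) (shift q (ℓ i)) ≡⟨ mate-insert q (map proj₁ w) (ℓ i) q≤∣map-w∣ ⟩
      shift q (mate (map proj₁ w) (ℓ i))                ≡⟨ cong (shift q) (down-steps I i (ℕₚ.≤-pred i<k+1)) ⟩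
      shift q (r i)                                     ≡⟨ sym (extend-old k q _ r i≢) ⟩
      r′ i                                              ∎
    where
    open ≡-Reasoning
    i≢ = i≤k⇒i≢ (ℕₚ.≤-pred i<k+1)
  ... | tri≈ _ refl _ = begin
      mate (map proj₁ w′) (ℓ′ (suc k))                ≡⟨ cong₂ mate (map-insertUD (suc k) q w) (extend-new k q _ ℓ) ⟩
      mate (insertPair q U D (map proj₁ w)) (suc q)   ≡⟨ mate-insert-new q (map proj₁ w) q≤∣map-w∣ ⟩
      suc (suc q)                                     ≡⟨ sym (extend-new k q _ r) ⟩
      r′ (suc k)                                      ∎
    where open ≡-Reasoning
  ... | tri> _ _ k+1<i = ⊥-elim (ℕₚ.<⇒≱ k+1<i i≤)

  ℓ′0≡0 : ℓ′ 0 ≡ 0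
  ℓ′0≡0 = trans (extend-old k q (suc q) ℓ (λ ())) (trans (cong (shift q) (ℓ0≡0 I)) (shift-≤ {q} {0} z≤n))

  G = growthStep k (ℓ k) T q (shape I) q≤2k

  invariant′ : GrowthInvariant (suc k) w′ (rgrowN T q) ℓ′ r′
  invariant′ = record
    { length≡ = length≡′
    ; up-steps = up-steps′
    ; down-steps = down-steps′
    ; separated = separated-step k q ℓ r (separated I)
    ; ℓ0≡0 = ℓ′0≡0
    ; shape = subst (λ a → GrowthShape (suc k) a (rgrowN T q)) (sym (extend-new k q _ ℓ)) (shape′ G)
    ; boxes≡ = λ j j≤ → begin
        boxesAtN (rgrowN T q) j
      ≡⟨ boxes′ G j j≤ ⟩
        boxesAtN T (unspread q j) + indicator (suc q ℕ.<? j ×-dec j ℕ.<? suc (suc (ℓ k)))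
      ≡⟨ cong (_+ indicator (suc q ℕ.<? j ×-dec j ℕ.<? suc (suc (ℓ k)))) (boxes≡ I (unspread q j) (unspread-≤ k q j q≤2k j≤)) ⟩
        coveringDescents k ℓ r (unspread q j) + indicator (suc q ℕ.<? j ×-dec j ℕ.<? suc (suc (ℓ k)))
      ≡⟨ sym (coveringDescents-step k q ℓ r (separated I) (ℓ0≡0 I) j) ⟩
        coveringDescents (suc k) ℓ′ r′ j ∎
    ; area≡ = begin
        + areaN (rgrowN T q)
      ≡⟨ cong +_ (trans (area′ G) (ℕₚ.+-assoc (areaN T) (2 * boxesAtN T q) (ℓ k ∸ q))) ⟩
        + areaN T ℤ.+ + (2 * boxesAtN T q + (ℓ k ∸ q))
      ≡⟨ cong₂ (λ a b → a ℤ.+ + (2 * b + (ℓ k ∸ q))) (area≡ I) (boxes≡ I q q≤2k) ⟩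
        areaRHS k ℓ r ℤ.+ + (2 * coveringDescents k ℓ r q + (ℓ k ∸ q))
      ≡⟨ sym (areaRHS-step k q ℓ r (separated I) (ℓ0≡0 I)) ⟩
        areaRHS (suc k) ℓ′ r′ ∎
    ; tiles≡ = begin
        + tilesN (rgrowN T q)
      ≡⟨ cong +_ (tiles′ G) ⟩
        + tilesN T ℤ.+ + (ℓ k ∸ q)
      ≡⟨ cong (ℤ._+ + (ℓ k ∸ q)) (tiles≡ I) ⟩
        tilesRHS k ℓ r ℤ.+ + (ℓ k ∸ q)
      ≡⟨ sym (tilesRHS-step k q ℓ r (separated I) (ℓ0≡0 I)) ⟩
        tilesRHS (suc k) ℓ′ r′ ∎
    }
    where open ≡-Reasoning

growthInvariant-empty : GrowthInvariant 0 [] emptyN (λ _ → 0) (λ _ → 0)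
growthInvariant-empty = record
  { length≡ = refl
  ; up-steps = λ { zero i () ; (suc x) i () }
  ; down-steps = λ { zero _ → refl }
  ; separated = λ i 1≤i ()
  ; ℓ0≡0 = refl
  ; shape = growthShape-empty
  ; boxes≡ = λ j _ → refl
  ; area≡ = refl
  ; tiles≡ = refl
  }

+-suc-length : ∀ k {A : Set} (x : A) xs → suc k + length xs ≡ k + length (x ∷ xs)
+-suc-length k x xs = sym (ℕₚ.+-suc k (length xs))

DTRfrom-toTiling : ∀ xs k a T → GrowthShape k a T → validFrom k xs →
  DTRfrom k xs (toTiling k T) ≡ toTiling (k + length xs) (DTRN xs T)
DTRfrom-toTiling [] k a T G _ = cong (λ K → toTiling K T) (sym (ℕₚ.+-identityʳ k))
DTRfrom-toTiling (x ∷ xs) k a T G (x≤2k , valid) = begin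
    DTRfrom (suc k) xs (rgrow (toTiling k T) (column k x))
  ≡⟨ cong (DTRfrom (suc k) xs) (rgrow-toTiling k T x (suc (suc (2 * k)))
       (columns-spread x (lowerN T) 0 (suc (2 * k)) (columns≡ G) z≤n (s≤s x≤2k))) ⟩
    DTRfrom (suc k) xs (toTiling (suc k) (rgrowN T x))
  ≡⟨ DTRfrom-toTiling xs (suc k) (suc x) (rgrowN T x) (shape′ (growthStep k a T x G x≤2k)) valid ⟩
    toTiling (suc k + length xs) (DTRN xs (rgrowN T x))
  ≡⟨ cong (λ K → toTiling K (DTRN xs (rgrowN T x))) (+-suc-length k x xs) ⟩
    toTiling (k + length (x ∷ xs)) (DTRN (x ∷ xs) T) ∎
  where open ≡-Reasoning

genFrom-invariant : ∀ xs k w T ℓ r → GrowthInvariant k w T ℓ r → validFrom k xs →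
  Σ[ ℓ* ∈ (ℕ → ℕ) ] Σ[ r* ∈ (ℕ → ℕ) ] GrowthInvariant (k + length xs) (genFrom k xs w) (DTRN xs T) ℓ* r*
genFrom-invariant [] k w T ℓ r I _ = ℓ , r , subst (λ K → GrowthInvariant K w T ℓ r) (sym (ℕₚ.+-identityʳ k)) I
genFrom-invariant (x ∷ xs) k w T ℓ r I (x≤2k , valid)
  with genFrom-invariant xs (suc k) (insertUD (suc k) x w) (rgrowN T x) _ _ (InvariantStep.invariant′ k w T ℓ r I x x≤2k) valid
... | ℓ* , r* , I* = ℓ* , r* , subst (λ K → GrowthInvariant K (genFrom (suc k) xs (insertUD (suc k) x w)) (DTRN xs (rgrowN T x)) ℓ* r*)
                                     (+-suc-length k x xs) I*

-- The right-hand sides only read ℓ and r at 1, …, n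

module RHSCong (n′ : ℕ) {ℓ ℓ′ r r′ : ℕ → ℕ}
               (ℓ≗ : ∀ i → 1 ≤ i → i ≤ suc n′ → ℓ i ≡ ℓ′ i) (r≗ : ∀ i → 1 ≤ i → i ≤ suc n′ → r i ≡ r′ i) where

  n = suc n′

  ℓ≗-index : ∀ {i} → 1 ≤ i × i ≤ n′ → ℓ i ≡ ℓ′ i
  ℓ≗-index (1≤i , i≤n′) = ℓ≗ _ 1≤i (ℕₚ.m≤n⇒m≤1+n i≤n′)

  ℓ≗-next : ∀ {i} → 1 ≤ i × i ≤ n′ → ℓ (suc i) ≡ ℓ′ (suc i)
  ℓ≗-next (_ , i≤n′) = ℓ≗ _ (s≤s z≤n) (s≤s i≤n′)

  r≗-next : ∀ {i} → 1 ≤ i × i ≤ n′ → r (suc i) ≡ r′ (suc i)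
  r≗-next (_ , i≤n′) = r≗ _ (s≤s z≤n) (s≤s i≤n′)

  indices : All (λ i → 1 ≤ i × i ≤ n′) (map suc (upTo n′))
  indices = subst (All (λ i → 1 ≤ i × i ≤ n′)) (sym (map-suc-upTo n′))
                  (All.map (λ p → proj₁ p , ℕₚ.≤-pred (proj₂ p)) (all-interval 1 n′))

  DES-cong : DES n ℓ ≡ DES n ℓ′
  DES-cong = filter-cong-local (λ i → ℓ (suc i) ℕ.<? ℓ i) (λ i → ℓ′ (suc i) ℕ.<? ℓ′ i)
    (All.map (λ p → cong₂ (λ a b → does (a ℕ.<? b)) (ℓ≗-next p) (ℓ≗-index p)) indices)

  descent-indices : All (λ i → 1 ≤ i × i ≤ n′) (DES n ℓ′)
  descent-indices = Allₚ.filter⁺ (λ i → ℓ′ (suc i) ℕ.<? ℓ′ i) indices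

  areaRHS-cong : areaRHS n ℓ r ≡ areaRHS n ℓ′ r′
  areaRHS-cong rewrite DES-cong = cong sumℤ (Listₚ.map-cong-local
    (All.map (λ p → cong₂ (λ a b → + a ℤ.- + b) (ℓ≗-index p) (r≗-next p)) descent-indices))

  crossCount-cong : ∀ i → 1 ≤ i × i ≤ n′ → crossCount n ℓ r i ≡ crossCount n ℓ′ r′ i
  crossCount-cong i (1≤i , i≤n′) = cong length (filter-cong-local _ _ (Allₚ.map⁺ (All.map same (Allₚ.all-upTo (n′ ∸ i)))))
    where
    same : ∀ {t} → t < n′ ∸ i → does (r (suc i) ℕ.<? ℓ (t + (2 + i)) ×-dec ℓ (t + (2 + i)) ℕ.<? ℓ i)
                                ≡ does (r′ (suc i) ℕ.<? ℓ′ (t + (2 + i)) ×-dec ℓ′ (t + (2 + i)) ℕ.<? ℓ′ i)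
    same {t} t< = cong₃ (λ a b c → does (a ℕ.<? b ×-dec b ℕ.<? c))
      (r≗-next (1≤i , i≤n′)) (ℓ≗ (t + (2 + i)) (ℕₚ.≤-trans (s≤s z≤n) (ℕₚ.m≤n+m (2 + i) t)) in-range) (ℓ≗-index (1≤i , i≤n′))
      where
      in-range : t + (2 + i) ≤ suc n′
      in-range = ℕₚ.≤-trans (ℕₚ.≤-reflexive (trans (ℕₚ.+-suc t (suc i)) (cong suc (ℕₚ.+-suc t i))))
                   (s≤s (ℕₚ.≤-trans (ℕₚ.+-monoˡ-< i t<) (ℕₚ.≤-reflexive (ℕₚ.m∸n+n≡m i≤n′))))

  tilesRHS-cong : tilesRHS n ℓ r ≡ tilesRHS n ℓ′ r′
  tilesRHS-cong rewrite DES-cong = cong sumℤ (Listₚ.map-cong-local (All.map (λ {i} p →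
    cong₃ (λ a b c → + a ℤ.- + b ℤ.- + (2 * c)) (ℓ≗-index p) (r≗-next p) (crossCount-cong i p)) descent-indices))

rhs-cong : ∀ n {ℓ ℓ′ r r′ : ℕ → ℕ} →
  (∀ i → 1 ≤ i → i ≤ n → ℓ i ≡ ℓ′ i) → (∀ i → 1 ≤ i → i ≤ n → r i ≡ r′ i) →
  (areaRHS n ℓ r ≡ areaRHS n ℓ′ r′) × (tilesRHS n ℓ r ≡ tilesRHS n ℓ′ r′)
rhs-cong zero _ _ = refl , refl
rhs-cong (suc n′) ℓ≗ r≗ = RHSCong.areaRHS-cong n′ ℓ≗ r≗ , RHSCong.tilesRHS-cong n′ ℓ≗ r≗

liftFin-agrees : ∀ {n} (f : Fin n → ℕ) (F : ℕ → ℕ) → (∀ j → f j ≡ F (suc (toℕ j))) →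
  ∀ i → 1 ≤ i → i ≤ n → liftFin f i ≡ F i
liftFin-agrees {n} f F f≗F (suc t) _ t<n with t ℕ.<? n
... | yes t<n′ = trans (f≗F (fromℕ< t<n′)) (cong (λ z → F (suc z)) (Finₚ.toℕ-fromℕ< t<n′))
... | no t≮n = ⊥-elim (t≮n t<n)

rhs-from-labels : ∀ {n} (lab : Fin n → ℕ) g T ℓ r → GrowthInvariant n g T ℓ r →
  (∀ j → at g (lab j) ≡ just (U , suc (toℕ j))) →
  (areaRHS n ℓ r ≡ areaRHS n (liftFin lab) (liftFin (λ i → mate (map proj₁ g) (lab i))))
  × (tilesRHS n ℓ r ≡ tilesRHS n (liftFin lab) (liftFin (λ i → mate (map proj₁ g) (lab i))))
rhs-from-labels {n} lab g T ℓ r I labels =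
  rhs-cong n (λ i 1≤i i≤n → sym (liftFin-agrees lab ℓ ℓ-labels i 1≤i i≤n))
             (λ i 1≤i i≤n → sym (liftFin-agrees (λ j → mate (map proj₁ g) (lab j)) r r-labels i 1≤i i≤n))
  where
  ℓ-labels : ∀ j → lab j ≡ ℓ (suc (toℕ j))
  ℓ-labels j = proj₂ (up-steps I (lab j) (suc (toℕ j)) (labels j))
  r-labels : ∀ j → mate (map proj₁ g) (lab j) ≡ r (suc (toℕ j))
  r-labels j = trans (cong (mate (map proj₁ g)) (ℓ-labels j)) (down-steps I (suc (toℕ j)) (Finₚ.toℕ<n j))

lemma2 : (n : ℕ) (w : List Step) → IsDyck n w →
         (lab : Fin n → ℕ) → NaturalLabeling n w lab →
         (p : List ℕ) → GrowthSeq n p → Generates p w lab →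
         (+ area (DTR p) ≡ areaRHS n (liftFin lab) (liftFin (λ i → mate w (lab i))))
         × (+ tiles (DTR p) ≡ tilesRHS n (liftFin lab) (liftFin (λ i → mate w (lab i))))
lemma2 _ _ _ lab _ p (refl , valid) (refl , labels)
  with genFrom-invariant p 0 [] emptyN (λ _ → 0) (λ _ → 0) growthInvariant-empty valid
... | ℓ , r , I = (begin
    + area (DTR p)                   ≡⟨ cong (λ T → + area T) DTR≡ ⟩
    + area (toTiling (length p) T)   ≡⟨ cong +_ (area-toTiling (length p) T) ⟩
    + areaN T                        ≡⟨ area≡ I ⟩
    areaRHS (length p) ℓ r           ≡⟨ proj₁ (rhs-from-labels lab (gen p) T ℓ r I labels) ⟩
    _                                ∎) , (begin
    + tiles (DTR p)                  ≡⟨ cong (λ T → + tiles T) DTR≡ ⟩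
    + tiles (toTiling (length p) T)  ≡⟨ cong +_ (tiles-toTiling (length p) T) ⟩
    + tilesN T                       ≡⟨ tiles≡ I ⟩
    tilesRHS (length p) ℓ r          ≡⟨ proj₂ (rhs-from-labels lab (gen p) T ℓ r I labels) ⟩
    _                                ∎)
  where
  open ≡-Reasoning
  T = DTRN p emptyN
  DTR≡ : DTR p ≡ toTiling (length p) T
  DTR≡ = DTRfrom-toTiling p 0 0 emptyN growthShape-empty valid
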